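{- Let $f:\{0,1\}^n\to\{0,1\}$ be a non-constant zebra function with $\operatorname{alt}(f)=k$ for some $k\ge 1$. Then \[ C(f)\le O\!\left(\operatorname{alt}(f)\max\{\mathsf{N}(f)^2,\mathsf{N}(\overline f)^2\}\right). \]
   Context: $C(f)$ is certificate complexity: the maximum over $x$ of the minimum size of a partial assignment consistent with $x$ that forces the value $f(x)$. $\mathsf{N}(f)$ is the minimum degree of a real polynomial $p$ with $|p(x)|\le 1/3$ whenever $f(x)=0$ and $|p(x)|\ge 1$ whenever $f(x)=1$; $\overline f=1-f$. A monotone path is a sequence $x^{(1)},\dots,x^{(m)}\in\{0,1\}^n$ where each $x^{(i+1)}$ is obtained from $x^{(i)}$ by changing exactly one coordinate from $0$ to $1$; its alternation number is the number of $i$ with $f(x^{(i)})\ne f(x^{(i+1)})$. $\operatorname{alt}(f)$ is the maximum alternation number over monotone paths from $0^n$ to $1^n$; $f$ is zebra if all monotone paths from $0^n$ to $1^n$ have the same alternation number. The $O(\cdot)$ hides an absolute constant.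
   Formalization: The polynomials defining N(f) and N(1−f) are taken with rational instead of real coefficients; the two versions of N agree, since a nonempty polyhedron with rational data has a rational point. -}

module Defs where

open import Data.Nat as ℕ using (ℕ; zero; suc)
open import Data.Bool using (Bool; true; false; not; _xor_)
open import Data.Maybe using (Maybe; just; nothing)
open import Data.Vec using (Vec; []; _∷_; lookup; replicate; _[_]≔_)
open import Data.Fin using (Fin)
open import Data.List using (List; []; _∷_; foldr)
open import Data.Product using (Σ; ∃; ∃-syntax; _×_; _,_; proj₁; proj₂)
open import Data.List.Relation.Unary.All using (All)
open import Data.Integer using (+_)
open import Data.Rational as ℚ using (ℚ; 0ℚ; 1ℚ; ∣_∣; _/_)
open import Relation.Binary.PropositionalEquality using (_≡_; _≢_)

Point : ℕ → Set
Point n = Vec Bool n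

BoolFun : ℕ → Set
BoolFun n = Point n → Bool

compl : ∀ {n} → BoolFun n → BoolFun n
compl f x = not (f x)

NonConstant : ∀ {n} → BoolFun n → Set
NonConstant f = ∃[ x ] ∃[ y ] (f x ≢ f y)

Step : ∀ {n} → Point n → Point n → Set
Step {n} x y = ∃[ i ] (lookup x i ≡ false × y ≡ x [ i ]≔ true)

data MPath {n : ℕ} : Point n → Point n → Set where
  done : ∀ {x} → MPath x x
  step : ∀ {x y z} → Step x y → MPath y z → MPath x z

altNum : ∀ {n} (f : BoolFun n) {x z : Point n} → MPath x z → ℕ
altNum f done = 0
altNum f (step {x = x} {y = y} _ p) with f x xor f y
... | true  = suc (altNum f p)
... | false = altNum f p

FullPath : ℕ → Set
FullPath n = MPath (replicate n false) (replicate n true)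

AltEq : ∀ {n} → BoolFun n → ℕ → Set
AltEq {n} f k =
  (∃[ p ] (altNum f {replicate n false} {replicate n true} p ≡ k)) ×
  ((p : FullPath n) → altNum f p ℕ.≤ k)

Zebra : ∀ {n} → BoolFun n → Set
Zebra {n} f = (p q : FullPath n) → altNum f p ≡ altNum f q

PartialAssignment : ℕ → Set
PartialAssignment n = Vec (Maybe Bool) n

size : ∀ {n} → PartialAssignment n → ℕ
size [] = 0
size (just _ ∷ ρ) = suc (size ρ)
size (nothing ∷ ρ) = size ρ

Consistent : ∀ {n} → PartialAssignment n → Point n → Set
Consistent {n} ρ x = (i : Fin n) (b : Bool) → lookup ρ i ≡ just b → lookup x i ≡ b

Certificate : ∀ {n} → BoolFun n → Point n → PartialAssignment n → Set
Certificate f x ρ = Consistent ρ x × ((y : Point _) → Consistent ρ y → f y ≡ f x)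

-- C(f) ≤ B, i.e. max_x min { size ρ | ρ certificate for x } ≤ B
CertComplexity≤ : ∀ {n} → BoolFun n → ℕ → Set
CertComplexity≤ {n} f B =
  (x : Point n) → ∃[ ρ ] (Certificate f x ρ × size ρ ℕ.≤ B)

Monomial : ℕ → Set
Monomial n = Vec ℕ n

Poly : ℕ → Set
Poly n = List (ℚ × Monomial n)

monoDeg : ∀ {n} → Monomial n → ℕ
monoDeg [] = 0
monoDeg (e ∷ es) = e ℕ.+ monoDeg es

DegreeAtMost : ∀ {n} → Poly n → ℕ → Set
DegreeAtMost p d = All (λ t → monoDeg (proj₂ t) ℕ.≤ d) p

bit : Bool → ℚ
bit true  = 1ℚ
bit false = 0ℚ

pow : ℚ → ℕ → ℚ
pow q zero = 1ℚ
pow q (suc e) = q ℚ.* pow q e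

evalMono : ∀ {n} → Monomial n → Point n → ℚ
evalMono [] [] = 1ℚ
evalMono (e ∷ es) (b ∷ bs) = pow (bit b) e ℚ.* evalMono es bs

eval : ∀ {n} → Poly n → Point n → ℚ
eval p x = foldr (λ t acc → (proj₁ t ℚ.* evalMono (proj₂ t) x) ℚ.+ acc) 0ℚ p

Approximates : ∀ {n} → Poly n → BoolFun n → Set
Approximates {n} p f = (x : Point n) →
  (f x ≡ false → ∣ eval p x ∣ ℚ.≤ (+ 1 / 3)) ×
  (f x ≡ true  → 1ℚ ℚ.≤ ∣ eval p x ∣)

NDeg≤ : ∀ {n} → BoolFun n → ℕ → Set
NDeg≤ {n} f d = ∃[ p ] (DegreeAtMost {n} p d × Approximates p f)

{-# OPTIONS --safe #-}

-- For a zebra function the number of alternations along a path from 0ⁿ to x depends only on x; call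
-- it the rank of x. It is monotone and its parity determines f, so a box z ≤ y ≤ z′ on whose two
-- corners the rank equals that of x certifies f x. If lowering any 1 of x lowers its rank, pick such
-- a lower neighbour and, recursively, a small z below it of the same rank: throughout [z , x] except
-- at x itself the rank is one less, so f differs from f x there. Hence an approximating polynomial
-- is large at one corner of this subcube and small elsewhere.
--
-- To bound the dimension m of such a subcube, average the polynomial over flipping each free
-- coordinate independently with probability u, starting from the corner. This is a polynomial q in u
-- of no larger degree d, with q 0 large, while for u ≥ 3/m the corner has weight at most 1/4 and
-- q u is small. Interpolating q at u = τ and u = 16 τ j², 1 ≤ j ≤ d, with τ = 3/m would contradict
-- this if 48 d² < m.
module Submission where

open import Defs
open import Data.Nat as ℕ using (ℕ; zero; suc)
import Data.Nat.Properties as ℕ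
open import Data.Bool as Bool using (Bool; true; false; not; _xor_; _∧_; if_then_else_; f≤t; b≤b)
import Data.Bool.Properties as Bool
open import Data.Fin using (zero; suc)
open import Data.Fin.Properties using (any?)
open import Data.Maybe using (Maybe; just; nothing)
open import Data.Vec using (Vec; []; _∷_; lookup; replicate; map; zipWith; head; _[_]≔_)
open import Data.Vec.Properties using (∷-injectiveʳ; lookup∘update; []≔-idempotent; []≔-lookup; map-[]≔; lookup-map)
open import Data.Vec.Relation.Binary.Pointwise.Inductive as Pointwise using (Pointwise; []; _∷_)
open import Data.Product using (∃; ∃-syntax; _×_; _,_; proj₁; proj₂)
open import Relation.Binary.PropositionalEquality
open import Relation.Nullary using (¬_; yes; no; contradiction)
open import Relation.Nullary.Decidable using (_×-dec_; from-no; from-yes)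
open import Function using (_∘_)

module CubePolynomials where
  open import Data.Nat.Combinatorics using (_C_; nCk≡nC[n∸k]; nCk+nC[k+1]≡[n+1]C[k+1]; k>n⇒nCk≡0; nCn≡1)
  import Data.Integer as ℤ
  open import Data.Rational
  open import Data.Rational.Properties
  open import Data.Rational.Solver using (module +-*-Solver)
  import Data.Fin.Subset as Subset
  open import Data.List using ([]; _∷_)
  open import Data.List.Relation.Unary.All using ([]; _∷_)
  open +-*-Solver using (solve; _:=_; _:+_; _:*_; _:-_; :-_; con)

  -- Order and reciprocals in the rationals.

  0≤-* : ∀ {p q} → 0ℚ ≤ p → 0ℚ ≤ q → 0ℚ ≤ p * q
  0≤-* {p} {q} 0≤p 0≤q =
    nonNegative⁻¹ (p * q) {{nonNeg*nonNeg⇒nonNeg p {{nonNegative 0≤p}} q {{nonNegative 0≤q}}}}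

  0≤-+ : ∀ {p q} → 0ℚ ≤ p → 0ℚ ≤ q → 0ℚ ≤ p + q
  0≤-+ = +-mono-≤

  *-monoˡ-≤ : ∀ {p q} r → 0ℚ ≤ r → p ≤ q → r * p ≤ r * q
  *-monoˡ-≤ r 0≤r = *-monoˡ-≤-nonNeg r {{nonNegative 0≤r}}

  *-monoʳ-≤ : ∀ {p q} r → 0ℚ ≤ r → p ≤ q → p * r ≤ q * r
  *-monoʳ-≤ r 0≤r = *-monoʳ-≤-nonNeg r {{nonNegative 0≤r}}

  p≤q⇒0≤q-p : ∀ {p q} → p ≤ q → 0ℚ ≤ q - p
  p≤q⇒0≤q-p {p} {q} p≤q = subst (_≤ q - p) (+-inverseʳ p) (+-monoˡ-≤ (- p) p≤q)

  0≤q-p⇒p≤q : ∀ {p q} → 0ℚ ≤ q - p → p ≤ q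
  0≤q-p⇒p≤q {p} {q} 0≤q-p = subst₂ _≤_ (+-identityˡ p)
    (solve 2 (λ p q → (q :- p) :+ p := q) refl p q) (+-monoˡ-≤ p 0≤q-p)

  p≤p+q : ∀ {p q} → 0ℚ ≤ q → p ≤ p + q
  p≤p+q {p} {q} 0≤q = subst (_≤ p + q) (+-identityʳ p) (+-monoʳ-≤ p 0≤q)

  -- Built by repeated addition so that `ι (suc n)` unfolds to `1ℚ + ι n`, the form in which the
  -- ring solver is applied to it.
  ι : ℕ → ℚ
  ι zero    = 0ℚ
  ι (suc n) = 1ℚ + ι n

  0≤1 : 0ℚ ≤ 1ℚ
  0≤1 = nonNegative⁻¹ 1ℚ

  0≤ι : ∀ n → 0ℚ ≤ ι n
  0≤ι zero    = ≤-refl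
  0≤ι (suc n) = 0≤-+ 0≤1 (0≤ι n)

  ι-+ : ∀ m n → ι (m ℕ.+ n) ≡ ι m + ι n
  ι-+ zero    n = sym (+-identityˡ (ι n))
  ι-+ (suc m) n = trans (cong (1ℚ +_) (ι-+ m n)) (sym (+-assoc 1ℚ (ι m) (ι n)))

  ι-* : ∀ m n → ι (m ℕ.* n) ≡ ι m * ι n
  ι-* zero    n = sym (*-zeroˡ (ι n))
  ι-* (suc m) n = trans (ι-+ n (m ℕ.* n)) (trans (cong (ι n +_) (ι-* m n))
    (solve 2 (λ m n → n :+ m :* n := (con 1ℚ :+ m) :* n) refl (ι m) (ι n)))

  ι-mono : ∀ {m n} → m ℕ.≤ n → ι m ≤ ι n
  ι-mono {n = n} ℕ.z≤n = 0≤ι n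
  ι-mono (ℕ.s≤s m≤n)   = +-monoʳ-≤ 1ℚ (ι-mono m≤n)

  ι-suc-positive : ∀ n → Positive (ι (suc n))
  ι-suc-positive n = pos+nonNeg⇒pos 1ℚ (ι n) {{nonNegative (0≤ι n)}}

  recip : ℕ → ℚ
  recip n = (1/ ι (suc n)) {{pos⇒nonZero (ι (suc n)) {{ι-suc-positive n}}}}

  ι*recip : ∀ n → ι (suc n) * recip n ≡ 1ℚ
  ι*recip n = *-inverseʳ (ι (suc n)) {{pos⇒nonZero (ι (suc n)) {{ι-suc-positive n}}}}

  0≤recip : ∀ n → 0ℚ ≤ recip n
  0≤recip n = <⇒≤ (positive⁻¹ (recip n) {{1/pos⇒pos (ι (suc n)) {{ι-suc-positive n}}}})

  -- Finite sums and forward differences.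

  ∑ : ℕ → (ℕ → ℚ) → ℚ
  ∑ zero    f = 0ℚ
  ∑ (suc n) f = ∑ n f + f n

  ∑-cong : ∀ n {f g : ℕ → ℚ} → (∀ t → f t ≡ g t) → ∑ n f ≡ ∑ n g
  ∑-cong zero    eq = refl
  ∑-cong (suc n) eq = cong₂ _+_ (∑-cong n eq) (eq n)

  ∑-+ : ∀ n (f g : ℕ → ℚ) → ∑ n (λ t → f t + g t) ≡ ∑ n f + ∑ n g
  ∑-+ zero    f g = refl
  ∑-+ (suc n) f g = trans (cong (_+ (f n + g n)) (∑-+ n f g))
    (solve 4 (λ a b c d → (a :+ b) :+ (c :+ d) := (a :+ c) :+ (b :+ d)) refl (∑ n f) (∑ n g) (f n) (g n))

  ∑-suc : ∀ n (f : ℕ → ℚ) → ∑ (suc n) f ≡ f 0 + ∑ n (f ∘ suc)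
  ∑-suc zero    f = +-comm 0ℚ (f 0)
  ∑-suc (suc n) f = trans (cong (_+ f (suc n)) (∑-suc n f)) (+-assoc (f 0) _ _)

  ∑-split : ∀ m n (f : ℕ → ℚ) → ∑ (m ℕ.+ n) f ≡ ∑ m f + ∑ n (λ t → f (m ℕ.+ t))
  ∑-split zero    n f = sym (+-identityˡ _)
  ∑-split (suc m) n f = begin
    ∑ (suc (m ℕ.+ n)) f                                 ≡⟨ ∑-suc (m ℕ.+ n) f ⟩
    f 0 + ∑ (m ℕ.+ n) (f ∘ suc)                         ≡⟨ cong (_+_ (f 0)) (∑-split m n (f ∘ suc)) ⟩
    f 0 + (∑ m (f ∘ suc) + ∑ n (λ t → f (suc m ℕ.+ t))) ≡⟨ sym (+-assoc (f 0) _ _) ⟩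
    f 0 + ∑ m (f ∘ suc) + ∑ n (λ t → f (suc m ℕ.+ t))   ≡⟨ cong (_+ ∑ n (λ t → f (suc m ℕ.+ t))) (sym (∑-suc m f)) ⟩
    ∑ (suc m) f + ∑ n (λ t → f (suc m ℕ.+ t))           ∎
    where open ≡-Reasoning

  ∑-telescope : ∀ n (f h : ℕ → ℚ) → (∀ t → t ℕ.< n → ∣ f t ∣ ≤ h (suc t) - h t) →
    ∣ ∑ n f ∣ ≤ h n - h 0
  ∑-telescope zero    f h bound = ≤-reflexive (sym (+-inverseʳ (h 0)))
  ∑-telescope (suc n) f h bound = begin
    ∣ ∑ n f + f n ∣                 ≤⟨ ∣p+q∣≤∣p∣+∣q∣ (∑ n f) (f n) ⟩
    ∣ ∑ n f ∣ + ∣ f n ∣             ≤⟨ +-mono-≤ (∑-telescope n f h (λ t t<n → bound t (ℕ.m<n⇒m<1+n t<n)))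
                                                  (bound n ℕ.≤-refl) ⟩
    (h n - h 0) + (h (suc n) - h n) ≡⟨ solve 3 (λ a b c → (a :- b) :+ (c :- a) := c :- b) refl (h n) (h 0) (h (suc n)) ⟩
    h (suc n) - h 0                 ∎
    where open ≤-Reasoning

  Δ : (ℕ → ℚ) → ℕ → ℚ
  Δ g t = g (suc t) - g t

  -- The `k`-th forward difference is identically zero: the discrete form of being a polynomial of
  -- degree below `k`.
  Vanishes : ℕ → (ℕ → ℚ) → Set
  Vanishes zero    g = ∀ t → g t ≡ 0ℚ
  Vanishes (suc k) g = Vanishes k (Δ g)

  vanishes-cong : ∀ k {g h : ℕ → ℚ} → (∀ t → g t ≡ h t) → Vanishes k g → Vanishes k h
  vanishes-cong zero    eq v t = trans (sym (eq t)) (v t)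
  vanishes-cong (suc k) eq v   = vanishes-cong k (λ t → cong₂ _-_ (eq (suc t)) (eq t)) v

  vanishes-+ : ∀ k {g h : ℕ → ℚ} → Vanishes k g → Vanishes k h → Vanishes k (λ t → g t + h t)
  vanishes-+ zero    v w t = cong₂ _+_ (v t) (w t)
  vanishes-+ (suc k) {g} {h} v w = vanishes-cong k
    (λ t → solve 4 (λ a b c d → (a :- b) :+ (c :- d) := (a :+ c) :- (b :+ d)) refl
      (g (suc t)) (g t) (h (suc t)) (h t))
    (vanishes-+ k v w)

  vanishes-0 : ∀ k → Vanishes k (λ _ → 0ℚ)
  vanishes-0 zero    _ = refl
  vanishes-0 (suc k)   = vanishes-0 k

  vanishes-const : ∀ k c → Vanishes (suc k) (λ _ → c)
  vanishes-const k c = vanishes-cong k (λ _ → sym (+-inverseʳ c)) (vanishes-0 k)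

  vanishes-* : ∀ k c {g : ℕ → ℚ} → Vanishes k g → Vanishes k (λ t → c * g t)
  vanishes-* zero    c v t = trans (cong (c *_) (v t)) (*-zeroʳ c)
  vanishes-* (suc k) c {g} v = vanishes-cong k
    (λ t → solve 3 (λ c a b → c :* (a :- b) := c :* a :- c :* b) refl c (g (suc t)) (g t))
    (vanishes-* k c v)

  vanishes-suc : ∀ k {g : ℕ → ℚ} → Vanishes k g → Vanishes (suc k) g
  vanishes-suc zero    v t = cong₂ _-_ (v (suc t)) (v t)
  vanishes-suc (suc k) v   = vanishes-suc k v

  vanishes-shift : ∀ k {g : ℕ → ℚ} → Vanishes k g → Vanishes k (g ∘ suc)
  vanishes-shift zero    v t = v (suc t)
  vanishes-shift (suc k) v   = vanishes-shift k v

  -- Discrete Leibniz rule: the difference of `(t - c) g` is `(t - c) Δ g` plus the shift of `g`.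
  -- The induction hypothesis handles the first summand, since `Δ g` vanishes one order earlier.
  vanishes-linear : ∀ k c {g : ℕ → ℚ} → Vanishes k g → Vanishes (suc k) (λ t → (ι t - c) * g t)
  vanishes-linear k c {g} v = vanishes-cong k leibniz (vanishes-+ k (linear-Δ k v) (vanishes-shift k v))
    where
    leibniz : ∀ t → (ι t - c) * Δ g t + g (suc t) ≡ (ι (suc t) - c) * g (suc t) - (ι t - c) * g t
    leibniz t = solve 4 (λ n c a b → (n :- c) :* (a :- b) :+ a := (con 1ℚ :+ n :- c) :* a :- (n :- c) :* b)
      refl (ι t) c (g (suc t)) (g t)
    linear-Δ : ∀ k → Vanishes k g → Vanishes k (λ t → (ι t - c) * Δ g t)
    linear-Δ zero    v t = trans (cong ((ι t - c) *_) (cong₂ _-_ (v (suc t)) (v t))) (*-zeroʳ (ι t - c))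
    linear-Δ (suc k) v   = vanishes-linear k c v

  sgn : ℕ → ℚ
  sgn zero    = 1ℚ
  sgn (suc n) = - sgn n

  ∣sgn∣ : ∀ n → ∣ sgn n ∣ ≡ 1ℚ
  ∣sgn∣ zero    = refl
  ∣sgn∣ (suc n) = trans (∣-p∣≡∣p∣ (sgn n)) (∣sgn∣ n)

  -- Term `t` of the binomial expansion of the `N`-th forward difference at 0. The exponent `N + t`
  -- has the parity of `N - t` without a truncated subtraction.
  alternating : ℕ → (ℕ → ℚ) → ℕ → ℚ
  alternating N g t = sgn (N ℕ.+ t) * ι (N C t) * g t

  nC0≡1 : ∀ n → n C 0 ≡ 1
  nC0≡1 n = trans (nCk≡nC[n∸k] {n = n} ℕ.z≤n) (nCn≡1 n)

  -- By Pascal's rule the expansion of order `suc N` for `g` regroups into the expansion of order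
  -- `N` for `Δ g`: `up` and `negated` collect the two shares, and the surplus last term carries the
  -- coefficient `N C suc N`, which is zero.
  vanishes⇒∑≡0 : ∀ N g → Vanishes N g → ∑ (suc N) (alternating N g) ≡ 0ℚ
  vanishes⇒∑≡0 zero    g v = trans (cong (λ p → 0ℚ + 1ℚ * ι 1 * p) (v 0)) refl
  vanishes⇒∑≡0 (suc N) g v = begin
    ∑ (suc (suc N)) (alternating (suc N) g)
      ≡⟨ ∑-suc (suc N) (alternating (suc N) g) ⟩
    alternating (suc N) g 0 + ∑ (suc N) (alternating (suc N) g ∘ suc)
      ≡⟨ cong₂ _+_ first (trans (∑-cong (suc N) pascal) (∑-+ (suc N) up down)) ⟩
    negated 0 + (∑ (suc N) up + ∑ (suc N) down)
      ≡⟨ solve 3 (λ a b c → a :+ (b :+ c) := b :+ (a :+ c)) refl (negated 0) (∑ (suc N) up) (∑ (suc N) down) ⟩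
    ∑ (suc N) up + (negated 0 + ∑ (suc N) (negated ∘ suc))
      ≡⟨ cong (_+_ (∑ (suc N) up)) (sym (∑-suc (suc N) negated)) ⟩
    ∑ (suc N) up + (∑ (suc N) negated + negated (suc N))
      ≡⟨ cong (λ p → ∑ (suc N) up + (∑ (suc N) negated + p)) last ⟩
    ∑ (suc N) up + (∑ (suc N) negated + 0ℚ)
      ≡⟨ cong (_+_ (∑ (suc N) up)) (+-identityʳ (∑ (suc N) negated)) ⟩
    ∑ (suc N) up + ∑ (suc N) negated
      ≡⟨ sym (∑-+ (suc N) up negated) ⟩
    ∑ (suc N) (λ t → up t + negated t)
      ≡⟨ ∑-cong (suc N) (λ t → solve 4 (λ s c a b → s :* c :* a :+ (:- s) :* c :* b := s :* c :* (a :- b)) refl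
           (sgn (N ℕ.+ t)) (ι (N C t)) (g (suc t)) (g t)) ⟩
    ∑ (suc N) (alternating N (Δ g))
      ≡⟨ vanishes⇒∑≡0 N (Δ g) v ⟩
    0ℚ ∎
    where
    open ≡-Reasoning
    up negated down : ℕ → ℚ
    up t      = sgn (N ℕ.+ t) * ι (N C t) * g (suc t)
    negated t = - sgn (N ℕ.+ t) * ι (N C t) * g t
    down      = negated ∘ suc
    first : alternating (suc N) g 0 ≡ negated 0
    first rewrite nC0≡1 N | nC0≡1 (suc N) = refl
    last : negated (suc N) ≡ 0ℚ
    last rewrite k>n⇒nCk≡0 (ℕ.n<1+n N) =
      solve 2 (λ s b → (:- s) :* con 0ℚ :* b := con 0ℚ) refl (sgn (N ℕ.+ suc N)) (g (suc N))
    pascal : ∀ t → alternating (suc N) g (suc t) ≡ up t + down t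
    pascal t rewrite sym (nCk+nC[k+1]≡[n+1]C[k+1] N t) | ι-+ (N C t) (N C suc t) | ℕ.+-suc N t =
      solve 4 (λ s a b x → (:- (:- s)) :* (a :+ b) :* x := s :* a :* x :+ (:- (:- s)) :* b :* x) refl
        (sgn (N ℕ.+ t)) (ι (N C t)) (ι (N C suc t)) (g (suc t))

  -- Unimodality of the binomial coefficients.

  C-mono : ∀ n k → k ℕ.+ suc k ℕ.≤ n → n C k ℕ.≤ n C suc k
  C-mono (suc n) zero    _ = begin
    suc n C 0       ≡⟨ trans (nC0≡1 (suc n)) (sym (nC0≡1 n)) ⟩
    n C 0           ≤⟨ ℕ.m≤m+n (n C 0) (n C 1) ⟩
    n C 0 ℕ.+ n C 1 ≡⟨ nCk+nC[k+1]≡[n+1]C[k+1] n 0 ⟩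
    suc n C 1       ∎
    where open ℕ.≤-Reasoning
  C-mono (suc n) (suc k) (ℕ.s≤s k+2+k≤n) = begin
    suc n C suc k                 ≡⟨ sym (nCk+nC[k+1]≡[n+1]C[k+1] n k) ⟩
    n C k ℕ.+ n C suc k           ≡⟨ ℕ.+-comm (n C k) (n C suc k) ⟩
    n C suc k ℕ.+ n C k           ≤⟨ ℕ.+-monoʳ-≤ (n C suc k) skip ⟩
    n C suc k ℕ.+ n C suc (suc k) ≡⟨ nCk+nC[k+1]≡[n+1]C[k+1] n (suc k) ⟩
    suc n C suc (suc k)           ∎
    where
    open ℕ.≤-Reasoning
    -- Pascal's rule on both sides leaves a comparison across two columns. On the boundary
    -- `n = 2k + 2` symmetry makes it an equality; beyond it both single steps are available by
    -- induction.
    skip : n C k ℕ.≤ n C suc (suc k)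
    skip with k ℕ.+ suc (suc k) ℕ.≟ n
    ... | yes refl = ℕ.≤-reflexive (trans (nCk≡nC[n∸k] (ℕ.m≤m+n k (suc (suc k))))
                       (cong (n C_) (ℕ.m+n∸m≡n k (suc (suc k)))))
    ... | no  ≢n   = ℕ.≤-trans
      (C-mono n k (ℕ.≤-trans (ℕ.+-monoʳ-≤ k (ℕ.n≤1+n (suc k))) k+2+k≤n))
      (C-mono n (suc k) (ℕ.≤∧≢⇒< k+2+k≤n ≢n))

  C-below-centre : ∀ D t j → t ℕ.+ j ≡ D → (D ℕ.+ D) C t ℕ.≤ (D ℕ.+ D) C D
  C-below-centre D t zero    eq rewrite ℕ.+-identityʳ t | eq = ℕ.≤-refl
  C-below-centre D t (suc j) eq = ℕ.≤-trans
    (C-mono (D ℕ.+ D) t (ℕ.+-mono-≤ (ℕ.<⇒≤ t<D) t<D))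
    (C-below-centre D (suc t) j (trans (sym (ℕ.+-suc t j)) eq))
    where
    t<D : t ℕ.< D
    t<D = subst (t ℕ.<_) eq (ℕ.m<m+n t ℕ.z<s)

  C-central : ∀ D t → (D ℕ.+ D) C t ℕ.≤ (D ℕ.+ D) C D
  C-central D t with t ℕ.≤? D | t ℕ.≤? D ℕ.+ D
  ... | yes t≤D | _        = C-below-centre D t (D ℕ.∸ t) (ℕ.m+[n∸m]≡n t≤D)
  ... | no  t≰D | yes t≤2D = subst (ℕ._≤ (D ℕ.+ D) C D) (sym (nCk≡nC[n∸k] t≤2D))
    (C-below-centre D (D ℕ.+ D ℕ.∸ t) (t ℕ.∸ D) (begin
      (D ℕ.+ D ℕ.∸ t) ℕ.+ (t ℕ.∸ D) ≡⟨ sym (ℕ.+-∸-assoc (D ℕ.+ D ℕ.∸ t) (ℕ.<⇒≤ (ℕ.≰⇒> t≰D))) ⟩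
      (D ℕ.+ D ℕ.∸ t) ℕ.+ t ℕ.∸ D   ≡⟨ cong (ℕ._∸ D) (ℕ.m∸n+n≡m t≤2D) ⟩
      D ℕ.+ D ℕ.∸ D                 ≡⟨ ℕ.m+n∸m≡n D D ⟩
      D                             ∎))
    where open ≡-Reasoning
  ... | no  _   | no  t≰2D = subst (ℕ._≤ (D ℕ.+ D) C D) (sym (k>n⇒nCk≡0 (ℕ.≰⇒> t≰2D))) ℕ.z≤n

  -- Polynomial functions of one rational variable.

  -- Degree at most d, by divisibility of q u - q a by u - a.
  IsPoly : ℕ → (ℚ → ℚ) → Set
  IsPoly zero    q = ∀ u v → q u ≡ q v
  IsPoly (suc d) q = ∀ a → ∃ λ r → IsPoly d r × (∀ u → q u ≡ q a + (u - a) * r u)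

  isPoly-cong : ∀ d {q r : ℚ → ℚ} → (∀ u → q u ≡ r u) → IsPoly d q → IsPoly d r
  isPoly-cong zero    eq P u v = trans (sym (eq u)) (trans (P u v) (eq v))
  isPoly-cong (suc d) eq P a with P a
  ... | s , S , q≡ = s , S , λ u → trans (sym (eq u)) (trans (q≡ u) (cong (_+ (u - a) * s u) (eq a)))

  isPoly-const : ∀ d c → IsPoly d (λ _ → c)
  isPoly-const zero    c u v = refl
  isPoly-const (suc d) c a   = (λ _ → 0ℚ) , isPoly-const d 0ℚ ,
    λ u → solve 2 (λ c x → c := c :+ x :* con 0ℚ) refl c (u - a)

  isPoly-+ : ∀ d {q r : ℚ → ℚ} → IsPoly d q → IsPoly d r → IsPoly d (λ u → q u + r u)
  isPoly-+ zero    P Q u v = cong₂ _+_ (P u v) (Q u v)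
  isPoly-+ (suc d) {q} {r} P Q a with P a | Q a
  ... | s , S , q≡ | t , T , r≡ = (λ u → s u + t u) , isPoly-+ d S T ,
    λ u → trans (cong₂ _+_ (q≡ u) (r≡ u))
      (solve 5 (λ a b x c d → (a :+ x :* c) :+ (b :+ x :* d) := (a :+ b) :+ x :* (c :+ d)) refl
        (q a) (r a) (u - a) (s u) (t u))

  isPoly-* : ∀ d c {q : ℚ → ℚ} → IsPoly d q → IsPoly d (λ u → c * q u)
  isPoly-* zero    c P u v = cong (c *_) (P u v)
  isPoly-* (suc d) c {q} P a with P a
  ... | s , S , q≡ = (λ u → c * s u) , isPoly-* d c S ,
    λ u → trans (cong (c *_) (q≡ u))
      (solve 4 (λ c a x s → c :* (a :+ x :* s) := c :* a :+ x :* (c :* s)) refl c (q a) (u - a) (s u))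

  isPoly-suc : ∀ d {q : ℚ → ℚ} → IsPoly d q → IsPoly (suc d) q
  isPoly-suc zero    {q} P a = (λ _ → 0ℚ) , (λ _ _ → refl) ,
    λ u → trans (P u a) (solve 2 (λ c x → c := c :+ x :* con 0ℚ) refl (q a) (u - a))
  isPoly-suc (suc d) P a with P a
  ... | s , S , q≡ = s , isPoly-suc d S , q≡

  isPoly-mono : ∀ {d e} {q : ℚ → ℚ} → d ℕ.≤ e → IsPoly d q → IsPoly e q
  isPoly-mono d≤e = go (ℕ.≤⇒≤′ d≤e)
    where
    go : ∀ {d e} {q : ℚ → ℚ} → d ℕ.≤′ e → IsPoly d q → IsPoly e q
    go ℕ.≤′-refl       P = P
    go (ℕ.≤′-step d≤e) P = isPoly-suc _ (go d≤e P)

  isPoly-linear : ∀ d α β {q : ℚ → ℚ} → IsPoly d q → IsPoly (suc d) (λ u → (α + β * u) * q u)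
  isPoly-linear zero    α β {q} P a = (λ u → β * q u) , isPoly-* zero β P ,
    λ u → trans (solve 5 (λ α β u a x → (α :+ β :* u) :* x := (α :+ β :* a) :* x :+ (u :- a) :* (β :* x))
                  refl α β u a (q u))
            (cong (λ y → (α + β * a) * y + (u - a) * (β * q u)) (P u a))
  isPoly-linear (suc d) α β {q} P a with P a
  ... | s , S , q≡ = (λ u → β * q u + (α + β * a) * s u) ,
    isPoly-+ (suc d) (isPoly-* (suc d) β P) (isPoly-suc d (isPoly-* d (α + β * a) S)) ,
    λ u → trans (cong ((α + β * u) *_) (q≡ u))
      (trans (solve 6 (λ α β u a x s → (α :+ β :* u) :* (x :+ (u :- a) :* s)
                         := (α :+ β :* a) :* x :+ (u :- a) :* (β :* (x :+ (u :- a) :* s) :+ (α :+ β :* a) :* s))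
                refl α β u a (q a) (s u))
        (cong (λ y → (α + β * a) * q a + (u - a) * (β * y + (α + β * a) * s u)) (sym (q≡ u))))

  -- Substituting a quadratic doubles the degree. Dividing at 0 leaves a constant plus `κ (t - c)²`
  -- times the substituted quotient, and each factor `t - c` costs one order through
  -- `vanishes-linear`.
  isPoly-quadratic-vanishes : ∀ d κ c {q : ℚ → ℚ} → IsPoly d q →
    Vanishes (suc (d ℕ.+ d)) (λ t → q (κ * ((ι t - c) * (ι t - c))))
  isPoly-quadratic-vanishes zero    κ c {q} P t =
    trans (cong (_- q _) (P _ (κ * ((ι t - c) * (ι t - c))))) (+-inverseʳ (q (κ * ((ι t - c) * (ι t - c)))))
  isPoly-quadratic-vanishes (suc d) κ c {q} P with P 0ℚ
  ... | s , S , q≡ rewrite ℕ.+-suc d d =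
    vanishes-cong k {λ t → q 0ℚ + κ * xxs t}
      (λ t → trans (solve 4 (λ x κ y z → z :+ κ :* (x :* (x :* y)) := z :+ (κ :* (x :* x) :- con 0ℚ) :* y) refl
                      (x t) κ (s (κ * (x t * x t))) (q 0ℚ))
               (sym (q≡ (κ * (x t * x t)))))
      (vanishes-+ k {λ _ → q 0ℚ} {λ t → κ * xxs t} (vanishes-const (suc (suc (d ℕ.+ d))) (q 0ℚ))
        (vanishes-* k κ {xxs} (vanishes-linear (suc (suc (d ℕ.+ d))) c {xs}
          (vanishes-linear (suc (d ℕ.+ d)) c {λ t → s (κ * (x t * x t))}
            (isPoly-quadratic-vanishes d κ c S)))))
    where
    k : ℕ
    k = suc (suc (suc (d ℕ.+ d)))
    x xs xxs : ℕ → ℚ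
    x t   = ι t - c
    xs t  = x t * s (κ * (x t * x t))
    xxs t = x t * xs t

  -- Extrapolation from quadratically spaced nodes.

  ∣p∣-scale : ∀ p q → 0ℚ ≤ p → ∣ p * q ∣ ≡ p * ∣ q ∣
  ∣p∣-scale p q 0≤p = trans (∣p*q∣≡∣p∣*∣q∣ p q) (cong (_* ∣ q ∣) (0≤p⇒∣p∣≡p 0≤p))

  ∣alternating∣ : ∀ N g t → ∣ alternating N g t ∣ ≡ ι (N C t) * ∣ g t ∣
  ∣alternating∣ N g t = begin
    ∣ sgn (N ℕ.+ t) * ι (N C t) * g t ∣     ≡⟨ cong ∣_∣ (*-assoc (sgn (N ℕ.+ t)) (ι (N C t)) (g t)) ⟩
    ∣ sgn (N ℕ.+ t) * (ι (N C t) * g t) ∣   ≡⟨ ∣p*q∣≡∣p∣*∣q∣ (sgn (N ℕ.+ t)) (ι (N C t) * g t) ⟩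
    ∣ sgn (N ℕ.+ t) ∣ * ∣ ι (N C t) * g t ∣ ≡⟨ cong₂ _*_ (∣sgn∣ (N ℕ.+ t)) (∣p∣-scale (ι (N C t)) (g t) (0≤ι (N C t))) ⟩
    1ℚ * (ι (N C t) * ∣ g t ∣)              ≡⟨ *-identityˡ _ ⟩
    ι (N C t) * ∣ g t ∣                     ∎
    where open ≡-Reasoning

  -- The central binomial coefficient is the largest, so a function killed by the 2D-th difference is
  -- bounded at the centre by the sum of its other values; the bounds y k - y (k + 1) at distance
  -- k + 1 telescope on either side.
  central-bound : ∀ D (g y : ℕ → ℚ) → Vanishes (D ℕ.+ D) g →
    (∀ t k → t ℕ.+ suc k ≡ D → ∣ g t ∣ ≤ y k - y (suc k)) →
    (∀ k → k ℕ.< D → ∣ g (suc D ℕ.+ k) ∣ ≤ y k - y (suc k)) →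
    ∣ g D ∣ ≤ (y 0 - y D) + (y 0 - y D)
  central-bound D g y v left right = *-cancelˡ-≤-pos c {{c-positive}} (begin
    c * ∣ g D ∣   ≡⟨ sym (∣alternating∣ N g D) ⟩
    ∣ a D ∣       ≡⟨ cong ∣_∣ centre ⟩
    ∣ - (L + R) ∣ ≡⟨ ∣-p∣≡∣p∣ (L + R) ⟩
    ∣ L + R ∣     ≤⟨ ∣p+q∣≤∣p∣+∣q∣ L R ⟩
    -- The distance to the centre falls along the left half and rises along the right half, hence
    -- the potentials `c * y (D ∸ t)` and `- (c * y t)` for the two telescoping sums.
    ∣ L ∣ + ∣ R ∣ ≤⟨ +-mono-≤ (∑-telescope D a (λ t → c * y (D ℕ.∸ t)) left′)
                                        (∑-telescope D (λ t → a (suc D ℕ.+ t)) (λ t → - (c * y t)) right′) ⟩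
    (c * y (D ℕ.∸ D) - c * y D) + (- (c * y D) - - (c * y 0))
                            ≡⟨ cong (λ n → (c * y n - c * y D) + (- (c * y D) - - (c * y 0))) (ℕ.n∸n≡0 D) ⟩
    (c * y 0 - c * y D) + (- (c * y D) - - (c * y 0))
                            ≡⟨ solve 3 (λ c a b → (c :* a :- c :* b) :+ (:- (c :* b) :- (:- (c :* a)))
                                          := c :* ((a :- b) :+ (a :- b))) refl c (y 0) (y D) ⟩
    c * ((y 0 - y D) + (y 0 - y D)) ∎)
    where
    open ≤-Reasoning
    N : ℕ
    N = D ℕ.+ D
    c L R : ℚ
    a : ℕ → ℚ
    c = ι (N C D)
    a = alternating N g
    L = ∑ D a
    R = ∑ D (λ t → a (suc D ℕ.+ t))
    c-positive : Positive c
    c-positive with N C D | subst (ℕ._≤ N C D) (nC0≡1 N) (C-central D 0)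
    ... | suc m | _ = ι-suc-positive m
    centre : a D ≡ - (L + R)
    centre = trans (solve 3 (λ l m r → m := (l :+ m :+ r) :- (l :+ r)) refl L (a D) R)
      (trans (cong (_- (L + R)) (trans (sym (∑-split (suc D) D a)) (vanishes⇒∑≡0 N g v)))
        (+-identityˡ (- (L + R))))
    weighted : ∀ t k → ∣ g t ∣ ≤ y k - y (suc k) → ∣ a t ∣ ≤ c * y k - c * y (suc k)
    weighted t k bound = begin
      ∣ a t ∣               ≡⟨ ∣alternating∣ N g t ⟩
      ι (N C t) * ∣ g t ∣   ≤⟨ *-monoʳ-≤ ∣ g t ∣ (0≤∣p∣ (g t)) (ι-mono (C-central D t)) ⟩
      c * ∣ g t ∣           ≤⟨ *-monoˡ-≤ c (0≤ι (N C D)) bound ⟩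
      c * (y k - y (suc k)) ≡⟨ solve 3 (λ c a b → c :* (a :- b) := c :* a :- c :* b) refl c (y k) (y (suc k)) ⟩
      c * y k - c * y (suc k) ∎
    left′ : ∀ t → t ℕ.< D → ∣ a t ∣ ≤ c * y (D ℕ.∸ suc t) - c * y (D ℕ.∸ t)
    left′ t t<D = subst (λ k → ∣ a t ∣ ≤ c * y (D ℕ.∸ suc t) - c * y k) (sym (ℕ.+-∸-assoc 1 t<D))
      (weighted t (D ℕ.∸ suc t) (left t (D ℕ.∸ suc t)
        (trans (ℕ.+-suc t (D ℕ.∸ suc t)) (ℕ.m+[n∸m]≡n t<D))))
    right′ : ∀ k → k ℕ.< D → ∣ a (suc D ℕ.+ k) ∣ ≤ - (c * y (suc k)) - - (c * y k)
    right′ k k<D = subst (∣ a (suc D ℕ.+ k) ∣ ≤_)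
      (solve 2 (λ a b → a :- b := (:- b) :- (:- a)) refl (c * y k) (c * y (suc k)))
      (weighted (suc D ℕ.+ k) k (right k k<D))

  -- The telescoping potential: the consecutive values `1/(2k+1)` and `1/(2k+3)` differ by
  -- `2/((2k+1)(2k+3))`, slightly more than `8/(16(k+1)² - 1)`, which is the rate at which the
  -- divided differences at the nodes decay.
  oddRecip : ℕ → ℚ
  oddRecip k = recip (k ℕ.+ k)

  1+2k*oddRecip : ∀ k → (1ℚ + (ι k + ι k)) * oddRecip k ≡ 1ℚ
  1+2k*oddRecip k = trans (cong (λ a → (1ℚ + a) * oddRecip k) (sym (ι-+ k k))) (ι*recip (k ℕ.+ k))

  3+2k*oddRecip : ∀ k → (ι 3 + (ι k + ι k)) * oddRecip (suc k) ≡ 1ℚ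
  3+2k*oddRecip k = trans
    (cong (_* oddRecip (suc k))
      (solve 1 (λ a → con (ι 3) :+ (a :+ a) := con 1ℚ :+ ((con 1ℚ :+ a) :+ (con 1ℚ :+ a))) refl (ι k)))
    (1+2k*oddRecip (suc k))

  oddRecip-difference : ∀ k → oddRecip k - oddRecip (suc k) ≡ ι 2 * (oddRecip k * oddRecip (suc k))
  oddRecip-difference k = begin
    y - z           ≡⟨ cong₂ _-_ (sym (*-identityʳ y)) (sym (*-identityʳ z)) ⟩
    y * 1ℚ - z * 1ℚ ≡⟨ cong₂ (λ s t → y * s - z * t) (sym (3+2k*oddRecip k)) (sym (1+2k*oddRecip k)) ⟩
    y * ((ι 3 + (ι k + ι k)) * z) - z * ((1ℚ + (ι k + ι k)) * y)
                                                ≡⟨ solve 3 (λ a y z →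
        y :* ((con (ι 3) :+ (a :+ a)) :* z) :- z :* ((con 1ℚ :+ (a :+ a)) :* y) := con (ι 2) :* (y :* z))
        refl (ι k) y z ⟩
    ι 2 * (y * z)   ∎
    where
    open ≡-Reasoning
    y z : ℚ
    y = oddRecip k
    z = oddRecip (suc k)

  -- 16(k+1)² - 1 = 4(2k+1)(2k+3) + 3
  oddRecip-gap : ∀ k → (ι 16 * (ι (suc k) * ι (suc k)) - 1ℚ) * (oddRecip k - oddRecip (suc k))
                       ≡ ι 8 + ι 6 * (oddRecip k * oddRecip (suc k))
  oddRecip-gap k = begin
    W * (y - z)         ≡⟨ cong (W *_) (oddRecip-difference k) ⟩
    W * (ι 2 * (y * z)) ≡⟨ solve 3 (λ a y z →
        (con (ι 16) :* ((con 1ℚ :+ a) :* (con 1ℚ :+ a)) :- con 1ℚ) :* (con (ι 2) :* (y :* z))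
        := con (ι 8) :* (((con 1ℚ :+ (a :+ a)) :* y) :* ((con (ι 3) :+ (a :+ a)) :* z)) :+ con (ι 6) :* (y :* z))
        refl (ι k) y z ⟩
    ι 8 * (((1ℚ + (ι k + ι k)) * y) * ((ι 3 + (ι k + ι k)) * z)) + ι 6 * (y * z)
                                                ≡⟨ cong₂ (λ s t → ι 8 * (s * t) + ι 6 * (y * z))
                                                     (1+2k*oddRecip k) (3+2k*oddRecip k) ⟩
    ι 8 + ι 6 * (y * z) ∎
    where
    open ≡-Reasoning
    W y z : ℚ
    W = ι 16 * (ι (suc k) * ι (suc k)) - 1ℚ
    y = oddRecip k
    z = oddRecip (suc k)

  -- Divide q u - q τ by u - τ and sample the quotient at 16 τ j²; its value at j = 0 governs q 0.
  extrapolation : ∀ e {q} → IsPoly (suc e) q → ∀ {τ M} → 0ℚ ≤ τ →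
    ι 16 * (ι (suc e) * ι (suc e)) * τ ≤ 1ℚ →
    (∀ u → τ ≤ u → u ≤ 1ℚ → ∣ q u ∣ ≤ M) →
    ι 8 * ∣ q 0ℚ ∣ ≤ ι 12 * M
  extrapolation e {q} P {τ} {M} 0≤τ 16D²τ≤1 bound with P τ
  ... | r , R-poly , q≡ = begin
    ι 8 * ∣ q 0ℚ ∣                    ≡⟨ sym (∣p∣-scale (ι 8) (q 0ℚ) (0≤ι 8)) ⟩
    ∣ ι 8 * q 0ℚ ∣                    ≡⟨ cong (λ p → ∣ ι 8 * p ∣) (q≡ 0ℚ) ⟩
    ∣ ι 8 * (q τ + (0ℚ - τ) * r 0ℚ) ∣ ≡⟨ cong ∣_∣ (solve 3 (λ a τ b →
        con (ι 8) :* (a :+ (con 0ℚ :- τ) :* b) := con (ι 8) :* a :- con (ι 8) :* τ :* b) refl (q τ) τ (r 0ℚ)) ⟩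
    ∣ ι 8 * q τ - R 0ℚ ∣              ≤⟨ ∣p-q∣≤∣p∣+∣q∣ (ι 8 * q τ) (R 0ℚ) ⟩
    ∣ ι 8 * q τ ∣ + ∣ R 0ℚ ∣          ≤⟨ +-mono-≤ atτ at0 ⟩
    ι 8 * M + ((M + M) + (M + M))     ≡⟨ solve 1 (λ M → con (ι 8) :* M :+ ((M :+ M) :+ (M :+ M)) := con (ι 12) :* M) refl M ⟩
    ι 12 * M                          ∎
    where
    open ≤-Reasoning
    D : ℕ
    D = suc e
    R : ℚ → ℚ
    -- The factor 8 matches the one in `oddRecip-gap`; `τ` absorbs the scale of the nodes, since
    -- `node k - τ` is `τ * W k`.
    R u = ι 8 * τ * r u
    node W y : ℕ → ℚ
    node k = ι 16 * τ * (ι (suc k) * ι (suc k))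
    W k = ι 16 * (ι (suc k) * ι (suc k)) - 1ℚ
    y k = (M + M) * oddRecip k
    g : ℕ → ℚ
    -- Centring at `D` makes both halves of `0 ≤ t ≤ 2D` run through the same nodes, while `g D` is
    -- `R 0ℚ`.
    g t = R (ι 16 * τ * ((ι t - ι D) * (ι t - ι D)))

    0≤W : ∀ k → 0ℚ ≤ W k
    0≤W k = subst (0ℚ ≤_)
      (solve 1 (λ a → con (ι 15) :+ (con (ι 32) :* a :+ con (ι 16) :* (a :* a))
                      := con (ι 16) :* ((con 1ℚ :+ a) :* (con 1ℚ :+ a)) :- con 1ℚ) refl (ι k))
      (0≤-+ (0≤ι 15) (0≤-+ (0≤-* (0≤ι 32) (0≤ι k)) (0≤-* (0≤ι 16) (0≤-* (0≤ι k) (0≤ι k)))))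

    node-τ : ∀ k → node k - τ ≡ τ * W k
    node-τ k = solve 2 (λ τ n → con (ι 16) :* τ :* (n :* n) :- τ := τ :* (con (ι 16) :* (n :* n) :- con 1ℚ))
      refl τ (ι (suc k))

    τ≤node : ∀ k → τ ≤ node k
    τ≤node k = 0≤q-p⇒p≤q (subst (0ℚ ≤_) (sym (node-τ k)) (0≤-* 0≤τ (0≤W k)))

    node≤1 : ∀ k → k ℕ.< D → node k ≤ 1ℚ
    node≤1 k k<D = begin
      node k                           ≡⟨ solve 2 (λ τ n → con (ι 16) :* τ :* (n :* n) := con (ι 16) :* τ :* n :* n)
                                           refl τ (ι (suc k)) ⟩
      ι 16 * τ * ι (suc k) * ι (suc k) ≤⟨ *-monoˡ-≤ _ (0≤-* (0≤-* (0≤ι 16) 0≤τ) (0≤ι (suc k))) (ι-mono k<D) ⟩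
      ι 16 * τ * ι (suc k) * ι D       ≤⟨ *-monoʳ-≤ (ι D) (0≤ι D)
                                          (*-monoˡ-≤ (ι 16 * τ) (0≤-* (0≤ι 16) 0≤τ) (ι-mono k<D)) ⟩
      ι 16 * τ * ι D * ι D             ≡⟨ solve 2 (λ τ n → con (ι 16) :* τ :* n :* n := con (ι 16) :* (n :* n) :* τ)
                                           refl τ (ι D) ⟩
      ι 16 * (ι D * ι D) * τ           ≤⟨ 16D²τ≤1 ⟩
      1ℚ                               ∎

    qτ≤M : ∣ q τ ∣ ≤ M
    qτ≤M = bound τ ≤-refl (≤-trans (τ≤node e) (node≤1 e ℕ.≤-refl))

    0≤M : 0ℚ ≤ M
    0≤M = ≤-trans (0≤∣p∣ (q τ)) qτ≤M

    0≤yz : ∀ k → 0ℚ ≤ oddRecip k * oddRecip (suc k)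
    0≤yz k = 0≤-* (0≤recip (k ℕ.+ k)) (0≤recip (suc k ℕ.+ suc k))

    0≤gap : ∀ k → 0ℚ ≤ oddRecip k - oddRecip (suc k)
    0≤gap k = subst (0ℚ ≤_) (sym (oddRecip-difference k)) (0≤-* (0≤ι 2) (0≤yz k))

    R-node : ∀ k → k ℕ.< D → ∣ R (node k) ∣ ≤ y k - y (suc k)
    R-node k k<D = begin
      ∣ ι 8 * τ * r u ∣       ≡⟨ cong ∣_∣ (*-assoc (ι 8) τ (r u)) ⟩
      ∣ ι 8 * (τ * r u) ∣     ≡⟨ ∣p∣-scale (ι 8) (τ * r u) (0≤ι 8) ⟩
      -- `oddRecip-gap` gives `W k * δ ≥ 8`; the factor `W k` then completes `τ * r u` to the
      -- increment `q u - q τ`, bounded by `M + M`.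
      ι 8 * ∣ τ * r u ∣       ≤⟨ *-monoʳ-≤ ∣ τ * r u ∣ (0≤∣p∣ (τ * r u))
                                         (subst (ι 8 ≤_) (sym (oddRecip-gap k)) (p≤p+q (0≤-* (0≤ι 6) (0≤yz k)))) ⟩
      W k * δ * ∣ τ * r u ∣   ≡⟨ solve 3 (λ w d a → w :* d :* a := d :* (w :* a)) refl (W k) δ ∣ τ * r u ∣ ⟩
      δ * (W k * ∣ τ * r u ∣) ≡⟨ cong (δ *_) (sym (∣p∣-scale (W k) (τ * r u) (0≤W k))) ⟩
      δ * ∣ W k * (τ * r u) ∣ ≡⟨ cong (λ p → δ * ∣ p ∣) increment ⟩
      δ * ∣ q u - q τ ∣       ≤⟨ *-monoˡ-≤ δ (0≤gap k) (≤-trans (∣p-q∣≤∣p∣+∣q∣ (q u) (q τ))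
                                         (+-mono-≤ (bound u (τ≤node k) (node≤1 k k<D)) qτ≤M)) ⟩
      δ * (M + M)             ≡⟨ solve 3 (λ a b m → (a :- b) :* m := m :* a :- m :* b) refl
                                          (oddRecip k) (oddRecip (suc k)) (M + M) ⟩
      y k - y (suc k)         ∎
      where
      u δ : ℚ
      u = node k
      δ = oddRecip k - oddRecip (suc k)
      increment : W k * (τ * r u) ≡ q u - q τ
      increment = trans (solve 3 (λ w τ a → w :* (τ :* a) := τ :* w :* a) refl (W k) τ (r u))
        (trans (cong (_* r u) (sym (node-τ k)))
          (trans (solve 2 (λ a b → b := (a :+ b) :- a) refl (q τ) ((u - τ) * r u))
            (cong (_- q τ) (sym (q≡ u)))))

    left : ∀ t k → t ℕ.+ suc k ≡ D → ∣ g t ∣ ≤ y k - y (suc k)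
    left t k eq = subst (λ p → ∣ R p ∣ ≤ y k - y (suc k)) place
      (R-node k (subst (k ℕ.<_) eq (ℕ.m≤n+m (suc k) t)))
      where
      place : node k ≡ ι 16 * τ * ((ι t - ι D) * (ι t - ι D))
      place = trans (solve 3 (λ τ a t → con (ι 16) :* τ :* (a :* a)
                        := con (ι 16) :* τ :* ((t :- (t :+ a)) :* (t :- (t :+ a)))) refl τ (ι (suc k)) (ι t))
        (cong (λ p → ι 16 * τ * ((ι t - p) * (ι t - p))) (trans (sym (ι-+ t (suc k))) (cong ι eq)))

    right : ∀ k → k ℕ.< D → ∣ g (suc D ℕ.+ k) ∣ ≤ y k - y (suc k)
    right k k<D = subst (λ p → ∣ R p ∣ ≤ y k - y (suc k)) place (R-node k k<D)
      where
      place : node k ≡ ι 16 * τ * ((ι (suc D ℕ.+ k) - ι D) * (ι (suc D ℕ.+ k) - ι D))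
      place = trans (solve 3 (λ τ a t → con (ι 16) :* τ :* (a :* a)
                        := con (ι 16) :* τ :* (((t :+ a) :- t) :* ((t :+ a) :- t))) refl τ (ι (suc k)) (ι D))
        (cong (λ p → ι 16 * τ * ((p - ι D) * (p - ι D))) (trans (sym (ι-+ D (suc k))) (cong ι (ℕ.+-suc D k))))

    g-vanishes : Vanishes (D ℕ.+ D) g
    g-vanishes = subst (λ k → Vanishes (suc k) g) (sym (ℕ.+-suc e e))
      -- The quotient has degree `e`, so `g` vanishes already at order `2e + 1`. One more order
      -- gives `D + D`, whose `2D + 1` sample points have a centre.
      (vanishes-suc (suc (e ℕ.+ e)) {g}
        (isPoly-quadratic-vanishes e (ι 16 * τ) (ι D) (isPoly-* e (ι 8 * τ) R-poly)))

    0≤yD : 0ℚ ≤ y D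
    0≤yD = 0≤-* (0≤-+ 0≤M 0≤M) (0≤recip (D ℕ.+ D))

    y0-yD≤2M : y 0 - y D ≤ M + M
    y0-yD≤2M = begin
      y 0 - y D ≤⟨ +-monoʳ-≤ (y 0) (neg-antimono-≤ 0≤yD) ⟩
      y 0 - 0ℚ  ≡⟨ solve 1 (λ m → m :* con 1ℚ :- con 0ℚ := m) refl (M + M) ⟩
      M + M     ∎

    at0 : ∣ R 0ℚ ∣ ≤ (M + M) + (M + M)
    at0 = begin
      ∣ R 0ℚ ∣                  ≡⟨ cong (λ p → ∣ R p ∣) (solve 2 (λ τ x → con 0ℚ :=
                                       con (ι 16) :* τ :* ((x :- x) :* (x :- x))) refl τ (ι D)) ⟩
      ∣ g D ∣                   ≤⟨ central-bound D g y g-vanishes left right ⟩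
      (y 0 - y D) + (y 0 - y D) ≤⟨ +-mono-≤ y0-yD≤2M y0-yD≤2M ⟩
      (M + M) + (M + M)         ∎

    atτ : ∣ ι 8 * q τ ∣ ≤ ι 8 * M
    atτ = subst (_≤ ι 8 * M) (sym (∣p∣-scale (ι 8) (q τ) (0≤ι 8))) (*-monoˡ-≤ (ι 8) (0≤ι 8) qτ≤M)

  -- Averages over random flips.

  -- One two-point average per marked coordinate. For `u` in `[0,1]` this is the expectation under
  -- independent flips, but it is defined for every rational `u`, so that it can be treated as a
  -- polynomial in `u`.
  flipMean : ∀ {n} → ℚ → Vec Bool n → Point n → (Point n → ℚ) → ℚ
  flipMean u []          []      g = g []
  flipMean u (false ∷ S) (b ∷ w) g = flipMean u S w (g ∘ (b ∷_))
  flipMean u (true  ∷ S) (b ∷ w) g =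
    (1ℚ - u) * flipMean u S w (g ∘ (b ∷_)) + u * flipMean u S w (g ∘ (not b ∷_))

  data Flip : ∀ {n} → Vec Bool n → Point n → Point n → Set where
    []   : Flip [] [] []
    keep : ∀ {n s b} {S : Vec Bool n} {w y} → Flip S w y → Flip (s ∷ S) (b ∷ w) (b ∷ y)
    flip : ∀ {n b} {S : Vec Bool n} {w y} → Flip S w y → Flip (true ∷ S) (b ∷ w) (not b ∷ y)

  flipMean-0 : ∀ {n} (S : Vec Bool n) w g → flipMean 0ℚ S w g ≡ g w
  flipMean-0 []          []      g = refl
  flipMean-0 (false ∷ S) (b ∷ w) g = flipMean-0 S w (g ∘ (b ∷_))
  flipMean-0 (true  ∷ S) (b ∷ w) g = trans
    (solve 2 (λ x y → (con 1ℚ :- con 0ℚ) :* x :+ con 0ℚ :* y := x) refl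
      (flipMean 0ℚ S w (g ∘ (b ∷_))) (flipMean 0ℚ S w (g ∘ (not b ∷_))))
    (flipMean-0 S w (g ∘ (b ∷_)))

  flipMean-zero : ∀ {n} u (S : Vec Bool n) w → flipMean u S w (λ _ → 0ℚ) ≡ 0ℚ
  flipMean-zero u []          []      = refl
  flipMean-zero u (false ∷ S) (b ∷ w) = flipMean-zero u S w
  flipMean-zero u (true  ∷ S) (b ∷ w) rewrite flipMean-zero u S w =
    solve 1 (λ u → (con 1ℚ :- u) :* con 0ℚ :+ u :* con 0ℚ := con 0ℚ) refl u

  flipMean-linear : ∀ {n} u (S : Vec Bool n) w c (g h : Point n → ℚ) →
    flipMean u S w (λ x → c * g x + h x) ≡ c * flipMean u S w g + flipMean u S w h
  flipMean-linear u []          []      c g h = refl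
  flipMean-linear u (false ∷ S) (b ∷ w) c g h = flipMean-linear u S w c (g ∘ (b ∷_)) (h ∘ (b ∷_))
  flipMean-linear u (true  ∷ S) (b ∷ w) c g h = trans
    (cong₂ (λ x y → (1ℚ - u) * x + u * y)
      (flipMean-linear u S w c (g ∘ (b ∷_)) (h ∘ (b ∷_)))
      (flipMean-linear u S w c (g ∘ (not b ∷_)) (h ∘ (not b ∷_))))
    (solve 6 (λ u c g₀ h₀ g₁ h₁ → (con 1ℚ :- u) :* (c :* g₀ :+ h₀) :+ u :* (c :* g₁ :+ h₁)
        := c :* ((con 1ℚ :- u) :* g₀ :+ u :* g₁) :+ ((con 1ℚ :- u) :* h₀ :+ u :* h₁)) refl
      u c (flipMean u S w (g ∘ (b ∷_))) (flipMean u S w (h ∘ (b ∷_)))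
      (flipMean u S w (g ∘ (not b ∷_))) (flipMean u S w (h ∘ (not b ∷_))))

  flipMean-* : ∀ {n} u (S : Vec Bool n) w c (g : Point n → ℚ) →
    flipMean u S w (λ x → c * g x) ≡ c * flipMean u S w g
  flipMean-* u []          []      c g = refl
  flipMean-* u (false ∷ S) (b ∷ w) c g = flipMean-* u S w c (g ∘ (b ∷_))
  flipMean-* u (true  ∷ S) (b ∷ w) c g = trans
    (cong₂ (λ x y → (1ℚ - u) * x + u * y)
      (flipMean-* u S w c (g ∘ (b ∷_))) (flipMean-* u S w c (g ∘ (not b ∷_))))
    (solve 4 (λ u c g₀ g₁ → (con 1ℚ :- u) :* (c :* g₀) :+ u :* (c :* g₁)
        := c :* ((con 1ℚ :- u) :* g₀ :+ u :* g₁)) refl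
      u c (flipMean u S w (g ∘ (b ∷_))) (flipMean u S w (g ∘ (not b ∷_))))

  pow-bit : ∀ b e → pow (bit b) (suc e) ≡ bit b
  pow-bit false e       = *-zeroˡ (pow 0ℚ e)
  pow-bit true  zero    = refl
  pow-bit true  (suc e) = trans (*-identityˡ (pow 1ℚ (suc e))) (pow-bit true e)

  -- Independence makes the average of a monomial a product over coordinates. As 0 and 1 are
  -- idempotent (`pow-bit`), a marked coordinate with positive exponent contributes a single factor
  -- linear in `u`, and any other coordinate a constant.
  flipMean-monomial : ∀ {n} (S : Vec Bool n) w (μ : Monomial n) →
    IsPoly (monoDeg μ) (λ u → flipMean u S w (evalMono μ))
  flipMean-monomial []          []      []           = λ _ _ → refl
  flipMean-monomial (false ∷ S) (b ∷ w) (e ∷ μ)      = isPoly-cong (e ℕ.+ monoDeg μ)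
    (λ u → sym (flipMean-* u S w (pow (bit b) e) (evalMono μ)))
    (isPoly-* (e ℕ.+ monoDeg μ) (pow (bit b) e) (isPoly-mono (ℕ.m≤n+m (monoDeg μ) e) (flipMean-monomial S w μ)))
  flipMean-monomial (true ∷ S) (b ∷ w) (zero ∷ μ)    = isPoly-cong (monoDeg μ)
    (λ u → trans
      (solve 2 (λ u x → x := (con 1ℚ :- u) :* (con 1ℚ :* x) :+ u :* (con 1ℚ :* x)) refl u (flipMean u S w (evalMono μ)))
      (sym (cong (λ x → (1ℚ - u) * x + u * x) (flipMean-* u S w 1ℚ (evalMono μ)))))
    (flipMean-monomial S w μ)
  flipMean-monomial (true ∷ S) (b ∷ w) (suc e ∷ μ)   = isPoly-cong (suc e ℕ.+ monoDeg μ)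
    (λ u → trans
      (solve 4 (λ u x b c → (b :+ (c :- b) :* u) :* x := (con 1ℚ :- u) :* (b :* x) :+ u :* (c :* x)) refl
        u (flipMean u S w (evalMono μ)) (bit b) (bit (not b)))
      (sym (cong₂ (λ x y → (1ℚ - u) * x + u * y) (factor u b) (factor u (not b)))))
    (isPoly-mono (ℕ.s≤s (ℕ.m≤n+m (monoDeg μ) e))
      (isPoly-linear (monoDeg μ) (bit b) (bit (not b) - bit b) (flipMean-monomial S w μ)))
    where
    factor : ∀ u b → flipMean u S w (λ x → pow (bit b) (suc e) * evalMono μ x) ≡ bit b * flipMean u S w (evalMono μ)
    factor u b = trans (flipMean-* u S w (pow (bit b) (suc e)) (evalMono μ))
      (cong (_* flipMean u S w (evalMono μ)) (pow-bit b e))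

  flipMean-isPoly : ∀ {n d} (S : Vec Bool n) w (p : Poly n) → DegreeAtMost p d →
    IsPoly d (λ u → flipMean u S w (eval p))
  flipMean-isPoly {d = d} S w []            []          =
    isPoly-cong d (λ u → sym (flipMean-zero u S w)) (isPoly-const d 0ℚ)
  flipMean-isPoly {d = d} S w ((c , μ) ∷ p) (μ≤d ∷ p≤d) = isPoly-cong d
    (λ u → sym (flipMean-linear u S w c (evalMono μ) (eval p)))
    (isPoly-+ d (isPoly-* d c (isPoly-mono μ≤d (flipMean-monomial S w μ))) (flipMean-isPoly S w p p≤d))

  average-≤ : ∀ u {x y A B} → 0ℚ ≤ u → u ≤ 1ℚ → ∣ x ∣ ≤ A → ∣ y ∣ ≤ B →
    ∣ (1ℚ - u) * x + u * y ∣ ≤ (1ℚ - u) * A + u * B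
  average-≤ u {x} {y} {A} {B} 0≤u u≤1 x≤A y≤B = begin
    ∣ (1ℚ - u) * x + u * y ∣     ≤⟨ ∣p+q∣≤∣p∣+∣q∣ ((1ℚ - u) * x) (u * y) ⟩
    ∣ (1ℚ - u) * x ∣ + ∣ u * y ∣ ≡⟨ cong₂ _+_ (∣p∣-scale (1ℚ - u) x (p≤q⇒0≤q-p u≤1)) (∣p∣-scale u y 0≤u) ⟩
    (1ℚ - u) * ∣ x ∣ + u * ∣ y ∣ ≤⟨ +-mono-≤ (*-monoˡ-≤ (1ℚ - u) (p≤q⇒0≤q-p u≤1) x≤A) (*-monoˡ-≤ u 0≤u y≤B) ⟩
    (1ℚ - u) * A + u * B         ∎
    where open ≤-Reasoning

  flipMean-≤ : ∀ {n} (S : Vec Bool n) w g {u B} → 0ℚ ≤ u → u ≤ 1ℚ →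
    (∀ y → Flip S w y → ∣ g y ∣ ≤ B) → ∣ flipMean u S w g ∣ ≤ B
  flipMean-≤ []          []      g 0≤u u≤1 bound = bound [] []
  flipMean-≤ (false ∷ S) (b ∷ w) g 0≤u u≤1 bound =
    flipMean-≤ S w (g ∘ (b ∷_)) 0≤u u≤1 (λ y F → bound (b ∷ y) (keep F))
  flipMean-≤ (true  ∷ S) (b ∷ w) g {u} {B} 0≤u u≤1 bound = ≤-trans
    (average-≤ u 0≤u u≤1
      (flipMean-≤ S w (g ∘ (b ∷_)) 0≤u u≤1 (λ y F → bound (b ∷ y) (keep F)))
      (flipMean-≤ S w (g ∘ (not b ∷_)) 0≤u u≤1 (λ y F → bound (not b ∷ y) (flip F))))
    (≤-reflexive (solve 2 (λ u x → (con 1ℚ :- u) :* x :+ u :* x := x) refl u B))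

  -- The corner has one factor `1 - u` per marked coordinate left unflipped; once the head is
  -- flipped the corner is left behind and `flipMean-≤` applies. The weight of all other vertices is
  -- rounded up to 1.
  flipMean-corner-≤ : ∀ {n} (S : Vec Bool n) w g {u B} → 0ℚ ≤ u → u ≤ 1ℚ → 0ℚ ≤ B →
    (∀ y → Flip S w y → y ≢ w → ∣ g y ∣ ≤ B) →
    ∣ flipMean u S w g ∣ ≤ pow (1ℚ - u) Subset.∣ S ∣ * ∣ g w ∣ + B
  flipMean-corner-≤ []          []      g {B = B} 0≤u u≤1 0≤B bound =
    ≤-trans (p≤p+q 0≤B) (≤-reflexive (cong (_+ B) (sym (*-identityˡ (∣ g [] ∣)))))
  flipMean-corner-≤ (false ∷ S) (b ∷ w) g 0≤u u≤1 0≤B bound =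
    flipMean-corner-≤ S w (g ∘ (b ∷_)) 0≤u u≤1 0≤B
      (λ y F y≢w → bound (b ∷ y) (keep F) (y≢w ∘ ∷-injectiveʳ))
  flipMean-corner-≤ (true  ∷ S) (b ∷ w) g {u} {B} 0≤u u≤1 0≤B bound = ≤-trans
    (average-≤ u 0≤u u≤1
      (flipMean-corner-≤ S w (g ∘ (b ∷_)) 0≤u u≤1 0≤B
        (λ y F y≢w → bound (b ∷ y) (keep F) (y≢w ∘ ∷-injectiveʳ)))
      (flipMean-≤ S w (g ∘ (not b ∷_)) 0≤u u≤1
        (λ y F → bound (not b ∷ y) (flip F) (Bool.not-¬ refl ∘ sym ∘ cong head))))
    (≤-reflexive (solve 4 (λ u B P V → (con 1ℚ :- u) :* (P :* V :+ B) :+ u :* B := (con 1ℚ :- u) :* P :* V :+ B) refl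
      u B (pow (1ℚ - u) Subset.∣ S ∣) (∣ g (b ∷ w) ∣)))

  -- The dimension of a subcube with a single large value.

  0≤pow : ∀ {q} m → 0ℚ ≤ q → 0ℚ ≤ pow q m
  0≤pow zero    0≤q = 0≤1
  0≤pow (suc m) 0≤q = 0≤-* 0≤q (0≤pow m 0≤q)

  -- The induction rests on `(1 - u)(1 + (m + 1)u) + (m + 1)u² = 1 + mu`.
  bernoulli : ∀ m u → 0ℚ ≤ u → u ≤ 1ℚ → pow (1ℚ - u) m * (1ℚ + ι m * u) ≤ 1ℚ
  bernoulli zero    u 0≤u u≤1 = ≤-reflexive (solve 1 (λ u → con 1ℚ :* (con 1ℚ :+ con 0ℚ :* u) := con 1ℚ) refl u)
  bernoulli (suc m) u 0≤u u≤1 = begin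
    (1ℚ - u) * P * (1ℚ + (1ℚ + ι m) * u) ≤⟨ p≤p+q (0≤-* 0≤P (0≤-* (0≤ι (suc m)) (0≤-* 0≤u 0≤u))) ⟩
    (1ℚ - u) * P * (1ℚ + (1ℚ + ι m) * u) + P * (ι (suc m) * (u * u))
      ≡⟨ solve 3 (λ u P m → (con 1ℚ :- u) :* P :* (con 1ℚ :+ (con 1ℚ :+ m) :* u) :+ P :* ((con 1ℚ :+ m) :* (u :* u))
                           := P :* (con 1ℚ :+ m :* u)) refl u P (ι m) ⟩
    P * (1ℚ + ι m * u)                   ≤⟨ bernoulli m u 0≤u u≤1 ⟩
    1ℚ                                   ∎
    where
    open ≤-Reasoning
    P : ℚ
    P = pow (1ℚ - u) m
    0≤P : 0ℚ ≤ P
    0≤P = 0≤pow m (p≤q⇒0≤q-p u≤1)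

  -- If the dimension exceeded `48 d²`, then `τ`, three over the dimension, would satisfy
  -- `16 d² τ ≤ 1`, and the averages on `[τ,1]` would be at most `V/4 + 1/3` in absolute value.
  -- Extrapolation to 0 would then give `8V ≤ 3V + 4`, contradicting `V ≥ 1`.
  flip-bound : ∀ {n} (p : Poly n) d → DegreeAtMost p d → (S : Vec Bool n) (w : Point n) →
    1ℚ ≤ ∣ eval p w ∣ → (∀ y → Flip S w y → y ≢ w → ∣ eval p y ∣ ≤ ℤ.+ 1 / 3) →
    Subset.∣ S ∣ ℕ.≤ 48 ℕ.* (d ℕ.* d)
  flip-bound p d p≤d S w 1≤V small = ℕ.≮⇒≥ (large-impossible d p≤d)
    where
    open ≤-Reasoning
    q : ℚ → ℚ
    q u = flipMean u S w (eval p)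
    V : ℚ
    V = ∣ eval p w ∣
    q0≡V : ∣ q 0ℚ ∣ ≡ V
    q0≡V = cong ∣_∣ (flipMean-0 S w (eval p))
    corner : ∀ {u} → 0ℚ ≤ u → u ≤ 1ℚ → ∣ q u ∣ ≤ pow (1ℚ - u) Subset.∣ S ∣ * V + (ℤ.+ 1 / 3)
    corner 0≤u u≤1 = flipMean-corner-≤ S w (eval p) 0≤u u≤1 (from-yes (0ℚ ≤? ℤ.+ 1 / 3)) small

    large-impossible : ∀ d → DegreeAtMost p d → ¬ (48 ℕ.* (d ℕ.* d) ℕ.< Subset.∣ S ∣)
    -- `extrapolation` divides once and so starts at degree 1. In degree 0 the average is constant,
    -- and at `u = 1` the corner has weight 0.
    large-impossible zero p≤0 0<m = from-no (1ℚ ≤? ℤ.+ 1 / 3) (begin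
      1ℚ                                    ≤⟨ 1≤V ⟩
      V                                     ≡⟨ sym q0≡V ⟩
      ∣ q 0ℚ ∣                              ≡⟨ cong ∣_∣ (flipMean-isPoly S w p p≤0 0ℚ 1ℚ) ⟩
      ∣ q 1ℚ ∣                              ≤⟨ corner 0≤1 ≤-refl ⟩
      pow 0ℚ Subset.∣ S ∣ * V + (ℤ.+ 1 / 3) ≡⟨ cong (λ x → x * V + (ℤ.+ 1 / 3)) (pow-0 0<m) ⟩
      0ℚ * V + (ℤ.+ 1 / 3)                  ≡⟨ solve 1 (λ V → con 0ℚ :* V :+ con (ℤ.+ 1 / 3) := con (ℤ.+ 1 / 3)) refl V ⟩
      ℤ.+ 1 / 3                             ∎)
      where
      pow-0 : ∀ {m} → 0 ℕ.< m → pow 0ℚ m ≡ 0ℚ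
      pow-0 {suc m} _ = *-zeroˡ (pow 0ℚ m)
    large-impossible (suc e) p≤d 48d²<m with Subset.∣ S ∣ | 48d²<m | (λ {u} → corner {u})
    -- The dimension is `suc m` from here on, so `recip m` is its reciprocal.
    ... | suc m | ℕ.s≤s 48d²≤m | corner = from-no (ι 5 ≤? ι 4) (begin
      ι 5                ≤⟨ *-monoˡ-≤ (ι 5) (0≤ι 5) 1≤V ⟩
      ι 5 * V            ≡⟨ solve 1 (λ V → con (ι 5) :* V := con (ι 8) :* V :- con (ι 3) :* V) refl V ⟩
      ι 8 * V - ι 3 * V  ≤⟨ +-monoˡ-≤ (- (ι 3 * V)) (subst (λ x → ι 8 * x ≤ ι 12 * M) q0≡V
                                    (extrapolation e (flipMean-isPoly S w p p≤d) 0≤τ 16d²τ≤1 bound)) ⟩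
      ι 12 * M - ι 3 * V ≡⟨ solve 1 (λ V → con (ι 12) :* (con (ℤ.+ 1 / 4) :* V :+ con (ℤ.+ 1 / 3)) :- con (ι 3) :* V
                                              := con (ι 4)) refl V ⟩
      ι 4                ∎)
      where
      τ M : ℚ
      τ = ι 3 * recip m
      M = (ℤ.+ 1 / 4) * V + (ℤ.+ 1 / 3)
      0≤τ : 0ℚ ≤ τ
      0≤τ = 0≤-* (0≤ι 3) (0≤recip m)
      16d²τ≤1 : ι 16 * (ι (suc e) * ι (suc e)) * τ ≤ 1ℚ
      16d²τ≤1 = begin
        ι 16 * (ι (suc e) * ι (suc e)) * (ι 3 * recip m)
          ≡⟨ solve 2 (λ x r → con (ι 16) :* x :* (con (ι 3) :* r) := con (ι 48) :* x :* r) refl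
               (ι (suc e) * ι (suc e)) (recip m) ⟩
        ι 48 * (ι (suc e) * ι (suc e)) * recip m
          ≡⟨ cong (_* recip m) (sym (trans (ι-* 48 (suc e ℕ.* suc e)) (cong (ι 48 *_) (ι-* (suc e) (suc e))))) ⟩
        ι (48 ℕ.* (suc e ℕ.* suc e)) * recip m
          ≤⟨ *-monoʳ-≤ (recip m) (0≤recip m) (ι-mono (ℕ.m≤n⇒m≤1+n 48d²≤m)) ⟩
        ι (suc m) * recip m
          ≡⟨ ι*recip m ⟩
        1ℚ ∎
      bound : ∀ u → τ ≤ u → u ≤ 1ℚ → ∣ q u ∣ ≤ M
      bound u τ≤u u≤1 = ≤-trans (corner 0≤u u≤1)
        (+-monoˡ-≤ (ℤ.+ 1 / 3) (*-monoʳ-≤ V (0≤∣p∣ (eval p w)) P≤¼))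
        where
        0≤u : 0ℚ ≤ u
        0≤u = ≤-trans 0≤τ τ≤u
        P : ℚ
        P = pow (1ℚ - u) (suc m)
        P≤¼ : P ≤ ℤ.+ 1 / 4
        P≤¼ = begin
          P                       ≡⟨ solve 1 (λ P → P := con (ℤ.+ 1 / 4) :* (P :* con (ι 4))) refl P ⟩
          (ℤ.+ 1 / 4) * (P * ι 4) ≤⟨ *-monoˡ-≤ (ℤ.+ 1 / 4) (from-yes (0ℚ ≤? ℤ.+ 1 / 4)) (begin
            -- With `τ = 3/(m + 1)` the factor `1 + (m + 1)τ` is exactly 4.
            P * ι 4                  ≡⟨ cong (λ x → P * (1ℚ + x)) (sym mτ≡3) ⟩
            P * (1ℚ + ι (suc m) * τ) ≤⟨ *-monoˡ-≤ P (0≤pow (suc m) (p≤q⇒0≤q-p u≤1))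
                                                  (+-monoʳ-≤ 1ℚ (*-monoˡ-≤ (ι (suc m)) (0≤ι (suc m)) τ≤u)) ⟩
            P * (1ℚ + ι (suc m) * u) ≤⟨ bernoulli (suc m) u 0≤u u≤1 ⟩
            1ℚ                       ∎) ⟩
          (ℤ.+ 1 / 4)             ∎
          where
          mτ≡3 : ι (suc m) * τ ≡ ι 3
          mτ≡3 = trans (solve 2 (λ x r → x :* (con (ι 3) :* r) := con (ι 3) :* (x :* r)) refl (ι (suc m)) (recip m))
            (cong (ι 3 *_) (ι*recip m))

open CubePolynomials using (Flip; []; keep; flip; flip-bound)
open import Data.Nat using (_≤_; _+_; _*_; _∸_; _⊔_; z≤n; s≤s)
open import Data.Fin.Subset using (∣_∣)

-- Monotone paths and ranks.

_++ᵖ_ : ∀ {n} {x y z : Point n} → MPath x y → MPath y z → MPath x z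
done     ++ᵖ q = q
step s p ++ᵖ q = step s (p ++ᵖ q)

jump : ∀ {n} → BoolFun n → Point n → Point n → ℕ
jump f x y = if f x xor f y then 1 else 0

altNum-step : ∀ {n} (f : BoolFun n) {x y z} (s : Step x y) (p : MPath y z) →
  altNum f (step s p) ≡ jump f x y + altNum f p
altNum-step f {x} {y} s p with f x xor f y
... | true  = refl
... | false = refl

altNum-++ : ∀ {n} (f : BoolFun n) {x y z} (p : MPath x y) (q : MPath y z) →
  altNum f (p ++ᵖ q) ≡ altNum f p + altNum f q
altNum-++ f done q = refl
altNum-++ f (step {x = x} {y = y} s p) q = begin
  altNum f (step s (p ++ᵖ q))            ≡⟨ altNum-step f s (p ++ᵖ q) ⟩
  jump f x y + altNum f (p ++ᵖ q)        ≡⟨ cong (jump f x y +_) (altNum-++ f p q) ⟩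
  jump f x y + (altNum f p + altNum f q) ≡⟨ sym (ℕ.+-assoc (jump f x y) _ _) ⟩
  jump f x y + altNum f p + altNum f q   ≡⟨ cong (_+ altNum f q) (sym (altNum-step f s p)) ⟩
  altNum f (step s p) + altNum f q       ∎
  where open ≡-Reasoning

infix 4 _⊑_
_⊑_ : ∀ {n} → Point n → Point n → Set
_⊑_ = Pointwise Bool._≤_

cons-path : ∀ {n} b {x y : Point n} → MPath x y → MPath (b ∷ x) (b ∷ y)
cons-path b done                     = done
cons-path b (step (i , i∉x , refl) p) = step (suc i , i∉x , refl) (cons-path b p)

⊑⇒path : ∀ {n} {x y : Point n} → x ⊑ y → MPath x y
⊑⇒path []             = done
⊑⇒path (f≤t ∷ x⊑y)    = step (zero , refl , refl) (cons-path true (⊑⇒path x⊑y))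
⊑⇒path (b≤b {b} ∷ x⊑y) = cons-path b (⊑⇒path x⊑y)

falses-⊑ : ∀ {n} (x : Point n) → replicate n false ⊑ x
falses-⊑ []          = []
falses-⊑ (false ∷ x) = b≤b ∷ falses-⊑ x
falses-⊑ (true  ∷ x) = f≤t ∷ falses-⊑ x

⊑-trues : ∀ {n} (x : Point n) → x ⊑ replicate n true
⊑-trues []          = []
⊑-trues (false ∷ x) = f≤t ∷ ⊑-trues x
⊑-trues (true  ∷ x) = b≤b ∷ ⊑-trues x

-- The potential through which the zebra property enters. Only its increments are prescribed, so
-- that reversing the cube can yield a ranking again.
record Ranking {n} (f : BoolFun n) : Set where
  field
    rank      : Point n → ℕ
    rank-step : ∀ {x y} → Step x y → rank y ≡ jump f x y + rank x

-- Counting along one canonical path is enough: the full path straight through `y` and the one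
-- through `x` and then `y` share their upper part, so the zebra property equates their totals and
-- the common part cancels.
zebra-ranking : ∀ {n} {f : BoolFun n} → Zebra f → Ranking f
zebra-ranking {n} {f} zebra = record { rank = height ; rank-step = height-step }
  where
  open ≡-Reasoning
  up : ∀ x → MPath (replicate n false) x
  up x = ⊑⇒path (falses-⊑ x)
  top : ∀ x → MPath x (replicate n true)
  top x = ⊑⇒path (⊑-trues x)
  height : Point n → ℕ
  height x = altNum f (up x)
  height-step : ∀ {x y} → Step x y → height y ≡ jump f x y + height x
  height-step {x} {y} s = ℕ.+-cancelʳ-≡ (altNum f (top y)) _ _ (begin
    height y + altNum f (top y)                ≡⟨ sym (altNum-++ f (up y) (top y)) ⟩
    altNum f (up y ++ᵖ top y)                  ≡⟨ zebra (up y ++ᵖ top y) (up x ++ᵖ step s (top y)) ⟩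
    altNum f (up x ++ᵖ step s (top y))         ≡⟨ altNum-++ f (up x) (step s (top y)) ⟩
    height x + altNum f (step s (top y))       ≡⟨ cong (height x +_) (altNum-step f s (top y)) ⟩
    height x + (jump f x y + altNum f (top y)) ≡⟨ sym (ℕ.+-assoc (height x) _ _) ⟩
    height x + jump f x y + altNum f (top y)   ≡⟨ cong (_+ altNum f (top y)) (ℕ.+-comm (height x) _) ⟩
    jump f x y + height x + altNum f (top y)   ∎)

zebra-rank-≤ : ∀ {n k} {f : BoolFun n} (zebra : Zebra f) → ((p : FullPath n) → altNum f p ≤ k) →
  ∀ x → Ranking.rank (zebra-ranking zebra) x ≤ k
zebra-rank-≤ {f = f} zebra alt≤k x = ℕ.≤-trans (ℕ.m≤m+n _ _)
  (subst (_≤ _) (altNum-++ f (⊑⇒path (falses-⊑ x)) (⊑⇒path (⊑-trues x)))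
    (alt≤k (⊑⇒path (falses-⊑ x) ++ᵖ ⊑⇒path (⊑-trues x))))

-- Descent to small points of equal rank.

odd : ℕ → Bool
odd zero    = false
odd (suc n) = not (odd n)

xor-cancelʳ : ∀ a b c → a xor c ≡ b xor c → a ≡ b
xor-cancelʳ false false c     eq = refl
xor-cancelʳ true  true  c     eq = refl
xor-cancelʳ false true  false ()
xor-cancelʳ false true  true  ()
xor-cancelʳ true  false false ()
xor-cancelʳ true  false true  ()

-- Unlike ordinary sensitivity, which looks at single flips, this asks `f` to differ from `f x` at
-- every other vertex of the subcube in the directions `S`, so that `x` is isolated there.
Sensitivity≤ : ∀ {n} → BoolFun n → ℕ → Set
Sensitivity≤ {n} f B = ∀ (S : Vec Bool n) x →
  (∀ y → Flip S x y → y ≢ x → f y ≢ f x) → ∣ S ∣ ≤ B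

_∖_ : ∀ {n} → Point n → Point n → Vec Bool n
_∖_ = zipWith (λ a b → a ∧ not b)

∣∖∣ : ∀ {n} {z x : Point n} → z ⊑ x → ∣ x ∣ ≡ ∣ x ∖ z ∣ + ∣ z ∣
∣∖∣ []                       = refl
∣∖∣ (f≤t ∷ z⊑x)              = cong suc (∣∖∣ z⊑x)
∣∖∣ (b≤b {false} ∷ z⊑x)      = ∣∖∣ z⊑x
∣∖∣ {z = _ ∷ z} {x = _ ∷ x} (b≤b {true} ∷ z⊑x) =
  trans (cong suc (∣∖∣ z⊑x)) (sym (ℕ.+-suc ∣ x ∖ z ∣ ∣ z ∣))

flip-∖-⊑ : ∀ {n} {z x y : Point n} → z ⊑ x → Flip (x ∖ z) x y → z ⊑ y × y ⊑ x
flip-∖-⊑ []                  []       = [] , []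
flip-∖-⊑ (f≤t ∷ z⊑x)         (keep F) = let z⊑y , y⊑x = flip-∖-⊑ z⊑x F in f≤t ∷ z⊑y , b≤b ∷ y⊑x
flip-∖-⊑ (f≤t ∷ z⊑x)         (flip F) = let z⊑y , y⊑x = flip-∖-⊑ z⊑x F in b≤b ∷ z⊑y , f≤t ∷ y⊑x
flip-∖-⊑ (b≤b {false} ∷ z⊑x) (keep F) = let z⊑y , y⊑x = flip-∖-⊑ z⊑x F in b≤b ∷ z⊑y , b≤b ∷ y⊑x
flip-∖-⊑ (b≤b {true}  ∷ z⊑x) (keep F) = let z⊑y , y⊑x = flip-∖-⊑ z⊑x F in b≤b ∷ z⊑y , b≤b ∷ y⊑x

lower-step : ∀ {n} (x : Point n) i → lookup x i ≡ true → Step (x [ i ]≔ false) x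
lower-step x i i∈x = i , lookup∘update i x false , sym (begin
  x [ i ]≔ false [ i ]≔ true ≡⟨ []≔-idempotent x i ⟩
  x [ i ]≔ true              ≡⟨ cong (x [ i ]≔_) (sym i∈x) ⟩
  x [ i ]≔ lookup x i        ≡⟨ []≔-lookup x i ⟩
  x                          ∎)
  where open ≡-Reasoning

∣lower∣ : ∀ {n} (x : Point n) i → lookup x i ≡ true → ∣ x ∣ ≡ suc ∣ x [ i ]≔ false ∣
∣lower∣ (true  ∷ x) zero    refl = refl
∣lower∣ (false ∷ x) (suc i) i∈x  = ∣lower∣ x i i∈x
∣lower∣ (true  ∷ x) (suc i) i∈x  = cong suc (∣lower∣ x i i∈x)

⊑-refl : ∀ {n} {x : Point n} → x ⊑ x
⊑-refl = Pointwise.refl b≤b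

⊑-trans : ∀ {n} {x y z : Point n} → x ⊑ y → y ⊑ z → x ⊑ z
⊑-trans = Pointwise.trans Bool.≤-trans

lower-⊑ : ∀ {n} (x : Point n) i → lookup x i ≡ true → x [ i ]≔ false ⊑ x
lower-⊑ (true ∷ x) zero    refl = f≤t ∷ ⊑-refl
lower-⊑ (b ∷ x)    (suc i) i∈x  = b≤b ∷ lower-⊑ x i i∈x

strictly-below : ∀ {n} {y x : Point n} → y ⊑ x → y ≢ x → ∃[ i ] (lookup x i ≡ true × y ⊑ x [ i ]≔ false)
strictly-below []           y≢x = contradiction refl y≢x
strictly-below (f≤t ∷ y⊑x)  y≢x = zero , refl , b≤b ∷ y⊑x
strictly-below (b≤b ∷ y⊑x)  y≢x =
  let i , i∈x , y⊑x↓i = strictly-below y⊑x (y≢x ∘ cong (_ ∷_)) in suc i , i∈x , b≤b ∷ y⊑x↓i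

empty⇒∣∣≡0 : ∀ {n} (x : Point n) → (∀ i → lookup x i ≢ true) → ∣ x ∣ ≡ 0
empty⇒∣∣≡0 []          none = refl
empty⇒∣∣≡0 (false ∷ x) none = empty⇒∣∣≡0 x (none ∘ suc)
empty⇒∣∣≡0 (true  ∷ x) none = contradiction refl (none zero)

module _ {n} {f : BoolFun n} (ranking : Ranking f) where
  open Ranking ranking

  path-rank-mono : ∀ {x y} → MPath x y → rank x ≤ rank y
  path-rank-mono done = ℕ.≤-refl
  path-rank-mono (step {x} {y} s p) = ℕ.≤-trans
    (subst (rank x ≤_) (sym (rank-step s)) (ℕ.m≤n+m (rank x) (jump f x y)))
    (path-rank-mono p)

  rank-mono : ∀ {x y} → x ⊑ y → rank x ≤ rank y
  rank-mono x⊑y = path-rank-mono (⊑⇒path x⊑y)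

  -- A step changes the value of `f` exactly when it changes the parity of the rank, so the xor of
  -- the two is invariant.
  path-parity : ∀ {x y} → MPath x y → f x xor odd (rank x) ≡ f y xor odd (rank y)
  path-parity done = refl
  path-parity (step {x} {y} s p) = trans (step-parity (rank-step s)) (path-parity p)
    where
    step-parity : rank y ≡ jump f x y + rank x → f x xor odd (rank x) ≡ f y xor odd (rank y)
    step-parity eq rewrite eq with f x | f y
    ... | false | false = refl
    ... | true  | true  = refl
    ... | false | true  = sym (Bool.not-involutive _)
    ... | true  | false = refl

  parity : ∀ {x y} → x ⊑ y → f x xor odd (rank x) ≡ f y xor odd (rank y)
  parity x⊑y = path-parity (⊑⇒path x⊑y)

  same-rank : ∀ {x y} → x ⊑ y → rank x ≡ rank y → f x ≡ f y
  same-rank {x} {y} x⊑y eq = xor-cancelʳ (f x) (f y) (odd (rank y))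
    (subst (λ r → f x xor odd r ≡ f y xor odd (rank y)) eq (parity x⊑y))

  next-rank : ∀ {x y} → x ⊑ y → rank y ≡ suc (rank x) → f x ≢ f y
  next-rank {x} {y} x⊑y eq fx≡fy = Bool.not-¬ refl (trans
    (subst₂ (λ b r → b xor odd (rank x) ≡ f y xor odd r) fx≡fy eq (parity x⊑y))
    (sym (Bool.not-distribʳ-xor (f y) (odd (rank x)))))

  lower-rank : ∀ x i → lookup x i ≡ true → rank (x [ i ]≔ false) ≢ rank x → rank x ≡ suc (rank (x [ i ]≔ false))
  lower-rank x i i∈x ≢ with rank-step (lower-step x i i∈x)
  ... | eq with f (x [ i ]≔ false) xor f x
  ...   | true  = eq
  ...   | false = contradiction (sym eq) ≢

  -- Each unit of rank pays for at most `B` ones. Lowering a coordinate at constant rank is free; a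
  -- point where this is impossible is its own witness, and the point found below it serves to bound
  -- its size.
  descend : ∀ {B} → Sensitivity≤ f B → ∀ m x → ∣ x ∣ ≡ m →
    ∃[ z ] (z ⊑ x × rank z ≡ rank x × ∣ z ∣ ≤ rank x * B)
  descend {B} sens zero x ∣x∣≡0 = x , ⊑-refl , refl , subst (_≤ rank x * B) (sym ∣x∣≡0) z≤n
  descend {B} sens (suc m) x ∣x∣≡m
    with any? (λ i → (lookup x i Bool.≟ true) ×-dec (rank (x [ i ]≔ false) ℕ.≟ rank x))
  ... | yes (i , i∈x , same) =
    let z , z⊑ , eq , small = descend sens m (x [ i ]≔ false) (ℕ.suc-injective (trans (sym (∣lower∣ x i i∈x)) ∣x∣≡m))
    in z , ⊑-trans z⊑ (lower-⊑ x i i∈x) , trans eq same , subst (λ r → ∣ z ∣ ≤ r * B) same small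
  ... | no minimal with any? (λ i → lookup x i Bool.≟ true)
  ...   | no  none      = contradiction (trans (sym ∣x∣≡m) (empty⇒∣∣≡0 x (λ i i∈x → none (i , i∈x)))) λ ()
  ...   | yes (i , i∈x) = x , ⊑-refl , refl , small
    where
    below : Point n
    below = x [ i ]≔ false
    recursive : ∃[ z ] (z ⊑ below × rank z ≡ rank below × ∣ z ∣ ≤ rank below * B)
    recursive = descend sens m below (ℕ.suc-injective (trans (sym (∣lower∣ x i i∈x)) ∣x∣≡m))
    z : Point n
    z = proj₁ recursive
    z⊑x : z ⊑ x
    z⊑x = ⊑-trans (proj₁ (proj₂ recursive)) (lower-⊑ x i i∈x)
    drop : ∀ j → lookup x j ≡ true → rank x ≡ suc (rank (x [ j ]≔ false))
    drop j j∈x = lower-rank x j j∈x (λ same → minimal (j , j∈x , same))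
    rank-x : rank x ≡ suc (rank z)
    rank-x = trans (drop i i∈x) (cong suc (sym (proj₁ (proj₂ (proj₂ recursive)))))
    all-differ : ∀ y → Flip (x ∖ z) x y → y ≢ x → f y ≢ f x
    all-differ y F y≢x with flip-∖-⊑ z⊑x F
    ... | z⊑y , y⊑x with strictly-below y⊑x y≢x
    -- `y` lies between `z` and some lower neighbour of `x`; both have rank one less than `x`, which
    -- pins the rank of `y`.
    ...   | j , j∈x , y⊑x↓j = next-rank y⊑x (trans rank-x (cong suc
      (ℕ.≤-antisym (rank-mono z⊑y)
        (ℕ.≤-trans (rank-mono y⊑x↓j) (ℕ.≤-reflexive (ℕ.suc-injective (trans (sym (drop j j∈x)) rank-x)))))))
    small : ∣ x ∣ ≤ rank x * B
    small = begin
      ∣ x ∣                ≡⟨ ∣∖∣ z⊑x ⟩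
      ∣ x ∖ z ∣ + ∣ z ∣    ≤⟨ ℕ.+-mono-≤ (sens (x ∖ z) x all-differ) (proj₂ (proj₂ (proj₂ recursive))) ⟩
      suc (rank below) * B ≡⟨ cong (_* B) (sym (drop i i∈x)) ⟩
      rank x * B           ∎
      where open ℕ.≤-Reasoning

-- Duality under complementing the input.

module _ {n} {f : BoolFun n} (ranking : Ranking f) {k} (rank≤k : ∀ x → Ranking.rank ranking x ≤ k) where
  open Ranking ranking

  dual-step : ∀ {x y : Point n} → Step x y → Step (map not y) (map not x)
  dual-step {x} (i , i∉x , refl) = subst (λ y → Step y (map not x)) (sym (map-[]≔ not x i))
    (lower-step (map not x) i (trans (lookup-map i not x) (cong not i∉x)))

  -- Complementing the input reverses every step, so `k` minus the rank grows by the same jumps. The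
  -- bound `rank≤k` keeps the truncated subtraction exact.
  dual-ranking : Ranking (f ∘ map not)
  dual-ranking = record
    { rank      = λ x → k ∸ rank (map not x)
    ; rank-step = λ {x} {y} s → complement (map not x) (map not y) (rank-step (dual-step s))
    }
    where
    complement : ∀ u v → rank u ≡ jump f v u + rank v →
      k ∸ rank v ≡ jump f u v + (k ∸ rank u)
    complement u v eq = begin
      k ∸ rank v                               ≡⟨ sym (ℕ.m+[n∸m]≡n jump≤) ⟩
      jump f v u + (k ∸ rank v ∸ jump f v u)   ≡⟨ cong (jump f v u +_) (ℕ.∸-+-assoc k (rank v) (jump f v u)) ⟩
      jump f v u + (k ∸ (rank v + jump f v u)) ≡⟨ cong₂ (λ j r → j + (k ∸ r))
                                                            (cong (λ b → if b then 1 else 0) (Bool.xor-comm (f v) (f u)))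
                                                            (trans (ℕ.+-comm (rank v) (jump f v u)) (sym eq)) ⟩
      jump f u v + (k ∸ rank u)                ∎
      where
      open ≡-Reasoning
      jump≤ : jump f v u ≤ k ∸ rank v
      jump≤ = ℕ.m+n≤o⇒m≤o∸n (jump f v u) (subst (_≤ k) eq (rank≤k u))

flip-map-not : ∀ {n} {S : Vec Bool n} {x y} → Flip S x y → Flip S (map not x) (map not y)
flip-map-not []       = []
flip-map-not (keep F) = keep (flip-map-not F)
flip-map-not (flip F) = flip (flip-map-not F)

map-not-involutive : ∀ {n} (x : Point n) → map not (map not x) ≡ x
map-not-involutive []      = refl
map-not-involutive (b ∷ x) = cong₂ _∷_ (Bool.not-involutive b) (map-not-involutive x)

dual-sensitivity : ∀ {n} {f : BoolFun n} {B} → Sensitivity≤ f B → Sensitivity≤ (f ∘ map not) B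
dual-sensitivity {f = f} sens S x differ = sens S (map not x) λ y F y≢ →
  subst (λ z → f z ≢ f (map not x)) (map-not-involutive y)
    (differ (map not y) (subst (λ z → Flip S z (map not y)) (map-not-involutive x) (flip-map-not F))
      (λ eq → y≢ (trans (sym (map-not-involutive y)) (cong (map not) eq))))

-- Certificates from boxes.

fix : Bool → Bool → Maybe Bool
fix true  _     = just true
fix false true  = just false
fix false false = nothing

-- The interval from `z` to `map not t`. The clash of two `true` entries, settled arbitrarily in
-- `fix`, cannot occur once `z ⊑ x` and `t ⊑ map not x`.
box : ∀ {n} → Point n → Point n → PartialAssignment n
box = zipWith fix

box-size : ∀ {n} (z t : Point n) → size (box z t) ≤ ∣ z ∣ + ∣ t ∣
box-size []          []          = z≤n
box-size (true ∷ z)  (false ∷ t) = s≤s (box-size z t)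
box-size (true ∷ z)  (true ∷ t)  = s≤s (ℕ.≤-trans (box-size z t) (ℕ.+-monoʳ-≤ ∣ z ∣ (ℕ.n≤1+n ∣ t ∣)))
box-size (false ∷ z) (true ∷ t)  = subst (suc (size (box z t)) ≤_) (sym (ℕ.+-suc ∣ z ∣ ∣ t ∣)) (s≤s (box-size z t))
box-size (false ∷ z) (false ∷ t) = box-size z t

box-consistent : ∀ {n} {z t x : Point n} → z ⊑ x → t ⊑ map not x → Consistent (box z t) x
box-consistent {x = true ∷ x}  (f≤t ∷ _) (b≤b ∷ _) zero b ()
box-consistent {x = true ∷ x}  (b≤b ∷ _) (b≤b ∷ _) zero b refl = refl
box-consistent {x = false ∷ x} (b≤b ∷ _) (f≤t ∷ _) zero b ()
box-consistent {x = false ∷ x} (b≤b ∷ _) (b≤b ∷ _) zero b refl = refl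
box-consistent {x = _ ∷ x}     (_ ∷ z⊑x) (_ ∷ t⊑x) (suc i) b eq = box-consistent z⊑x t⊑x i b eq

consistent-box : ∀ {n} (z t x y : Point n) → z ⊑ x → t ⊑ map not x → Consistent (box z t) y →
  z ⊑ y × t ⊑ map not y
consistent-box [] [] [] [] [] [] _ = [] , []
consistent-box (c ∷ z) (d ∷ t) (a ∷ x) (b ∷ y) (c≤a ∷ z⊑x) (d≤a ∷ t⊑x) cons =
  let z⊑y , t⊑y = consistent-box z t x y z⊑x t⊑x (cons ∘ suc)
      c≤b , d≤b = head-≤ c d a b c≤a d≤a (cons zero)
  in c≤b ∷ z⊑y , d≤b ∷ t⊑y
  where
  head-≤ : ∀ c d a b → c Bool.≤ a → d Bool.≤ not a → (∀ e → fix c d ≡ just e → b ≡ e) →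
    c Bool.≤ b × d Bool.≤ not b
  head-≤ true  false true  b b≤b b≤b forced rewrite forced true refl  = b≤b , b≤b
  head-≤ false true  false b b≤b b≤b forced rewrite forced false refl = b≤b , b≤b
  head-≤ false false a     b _   _   forced = Bool.≤-minimum b , Bool.≤-minimum (not b)
  head-≤ true  true  true  b b≤b ()

-- Descent gives the lower corner; the upper one comes from descent for the dual at `map not x`.
-- Their budgets `rank x * B` and `(k ∸ rank x) * B` add up to `k * B`.
certificate : ∀ {n} {f : BoolFun n} (ranking : Ranking f) {k B} →
  (∀ x → Ranking.rank ranking x ≤ k) → Sensitivity≤ f B → CertComplexity≤ f (k * B)
certificate {n} {f} ranking {k} {B} rank≤k sens x = box z t , (box-consistent z⊑x t⊑x , forces) , small
  where
  open Ranking ranking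
  dual : Ranking (f ∘ map not)
  dual = dual-ranking ranking rank≤k
  lower : ∃[ z ] (z ⊑ x × rank z ≡ rank x × ∣ z ∣ ≤ rank x * B)
  lower = descend ranking sens ∣ x ∣ x refl
  upper : ∃[ t ] (t ⊑ map not x × k ∸ rank (map not t) ≡ k ∸ rank (map not (map not x))
                  × ∣ t ∣ ≤ (k ∸ rank (map not (map not x))) * B)
  upper = descend dual (dual-sensitivity sens) ∣ map not x ∣ (map not x) refl
  z t : Point n
  z = proj₁ lower
  t = proj₁ upper
  z⊑x : z ⊑ x
  z⊑x = proj₁ (proj₂ lower)
  t⊑x : t ⊑ map not x
  t⊑x = proj₁ (proj₂ upper)
  small : size (box z t) ≤ k * B
  small = begin
    size (box z t)                ≤⟨ box-size z t ⟩
    ∣ z ∣ + ∣ t ∣                 ≤⟨ ℕ.+-mono-≤ (proj₂ (proj₂ (proj₂ lower)))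
                                                 (subst (λ y → ∣ t ∣ ≤ (k ∸ rank y) * B) (map-not-involutive x)
                                                   (proj₂ (proj₂ (proj₂ upper)))) ⟩
    rank x * B + (k ∸ rank x) * B ≡⟨ sym (ℕ.*-distribʳ-+ B (rank x) (k ∸ rank x)) ⟩
    (rank x + (k ∸ rank x)) * B   ≡⟨ cong (_* B) (ℕ.m+[n∸m]≡n (rank≤k x)) ⟩
    k * B                         ∎
    where open ℕ.≤-Reasoning
  forces : ∀ y → Consistent (box z t) y → f y ≡ f x
  forces y cons with consistent-box z t x y z⊑x t⊑x cons
  -- `f y` and `f x` are compared through `z`, which lies below both points and has their common
  -- rank.
  ... | z⊑y , t⊑y = trans (sym (same-rank ranking z⊑y (trans rank-z (sym rank-y)))) (same-rank ranking z⊑x rank-z)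
    where
    open ℕ.≤-Reasoning
    rank-z : rank z ≡ rank x
    rank-z = proj₁ (proj₂ (proj₂ lower))
    rank-y : rank y ≡ rank x
    -- The upper corner bounds `rank y` from above, by monotonicity of the dual rank; `z` bounds it
    -- from below.
    rank-y = ℕ.≤-antisym
      (ℕ.∸-cancelʳ-≤ (rank≤k y) (begin
        k ∸ rank x                     ≡⟨ cong (λ v → k ∸ rank v) (sym (map-not-involutive x)) ⟩
        k ∸ rank (map not (map not x)) ≡⟨ sym (proj₁ (proj₂ (proj₂ upper))) ⟩
        k ∸ rank (map not t)           ≤⟨ rank-mono dual t⊑y ⟩
        k ∸ rank (map not (map not y)) ≡⟨ cong (λ v → k ∸ rank v) (map-not-involutive y) ⟩
        k ∸ rank y                     ∎))
      (subst (_≤ rank y) rank-z (rank-mono ranking z⊑y))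

-- Around an isolated point of value 1 the polynomial for `f` is large at that point and small on
-- the rest of the subcube; for value 0 the polynomial for `compl f` takes this role. Either way
-- `flip-bound` applies.
sensitivity-≤ : ∀ {n} {f : BoolFun n} {d d′} → NDeg≤ f d → NDeg≤ (compl f) d′ →
  Sensitivity≤ f (48 * ((d * d) ⊔ (d′ * d′)))
sensitivity-≤ {f = f} {d} {d′} (p , p≤d , p≈f) (q , q≤d′ , q≈f̄) S x differ with f x in fx
... | true  = ℕ.≤-trans
  (flip-bound p d p≤d S x (proj₂ (p≈f x) fx) (λ y F y≢x → proj₁ (p≈f y) (Bool.¬-not (differ y F y≢x))))
  (ℕ.*-monoʳ-≤ 48 (ℕ.m≤m⊔n (d * d) (d′ * d′)))
... | false = ℕ.≤-trans
  (flip-bound q d′ q≤d′ S x (proj₂ (q≈f̄ x) (cong not fx))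
    (λ y F y≢x → proj₁ (q≈f̄ y) (cong not (Bool.¬-not (differ y F y≢x)))))
  (ℕ.*-monoʳ-≤ 48 (ℕ.m≤n⊔m (d * d) (d′ * d′)))

theorem1 : ∃[ c ] ((n : ℕ) (f : BoolFun n) (k : ℕ) → 1 ≤ k →
    NonConstant f → Zebra f → AltEq f k →
    (d d′ : ℕ) → NDeg≤ f d → NDeg≤ (compl f) d′ →
    CertComplexity≤ f (c * k * ((d * d) ⊔ (d′ * d′))))
-- The constant is that of `flip-bound`; what remains is to reorder `k * (48 * _)`.
theorem1 = 48 , λ n f k _ _ zebra (_ , alt≤k) d d′ p q →
  subst (CertComplexity≤ f)
    (trans (sym (ℕ.*-assoc k 48 ((d * d) ⊔ (d′ * d′)))) (cong (_* ((d * d) ⊔ (d′ * d′))) (ℕ.*-comm k 48)))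
    (certificate (zebra-ranking zebra) (zebra-rank-≤ zebra alt≤k) (sensitivity-≤ p q))
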